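{- If there is a polynomial-time algorithm solving the problem CMI restricted to acyclic implicational bases, then there is a polynomial-time algorithm solving the problem DUAL restricted to implicational bases in which every premise has size one (i.e., the problem DUAL in distributive lattices).
   Context: All sets are finite. A unit implicational base on $X$ is a set $\Sigma$ of implications $A\to b$, $A\subseteq X$, $b\in X$. A set $S\subseteq X$ is closed in $\Sigma$ if for every $A\to b\in\Sigma$, $A\not\subseteq S$ or $b\in S$; $\mathcal{C}_\Sigma$ is the family of closed sets and $\mathcal{L}_\Sigma=(\mathcal{C}_\Sigma,\subseteq)$ is a lattice. The implication graph of $\Sigma$ has vertex set $X$ and an arc $x\to y$ iff some $A\to y\in\Sigma$ has $x\in A$; $\Sigma$ is acyclic if this graph has no directed cycle. When all premises have size one, $\mathcal{L}_\Sigma$ is distributive (and every distributive lattice arises this way). A set $M$ is meet-irreducible in $\mathcal{C}_\Sigma$ if $M\in\mathcal{C}_\Sigma$, $M\ne X$, and $M=C_1\cap C_2$ with $C_1,C_2\in\mathcal{C}_\Sigma$ implies $C_1=M$ or $C_2=M$; $\mathcal{M}(\mathcal{C}_\Sigma)$ is the set of these. For $\mathcal{B}\subseteq\mathcal{C}_\Sigma$, $\downarrow\mathcal{B}=\{C\in\mathcal{C}_\Sigma: C\subseteq B \text{ for some } B\in\mathcal{B}\}$ and $\uparrow\mathcal{B}=\{C\in\mathcal{C}_\Sigma: B\subseteq C\text{ for some }B\in\mathcal{B}\}$. Problem DUAL: given $X$, $\Sigma$ and two antichains $\mathcal{B}^+,\mathcal{B}^-$ of $\mathcal{L}_\Sigma$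 (the lattice itself is not given), decide whether $\downarrow\mathcal{B}^+\cap\uparrow\mathcal{B}^-=\emptyset$ and $\downarrow\mathcal{B}^+\cup\uparrow\mathcal{B}^-=\mathcal{C}_\Sigma$. Problem CMI: given $X$, an implicational base $\Sigma$ and a family $\mathcal{M}\subseteq 2^X$, decide whether $\mathcal{M}=\mathcal{M}(\mathcal{C}_\Sigma)$. Polynomial time is measured in the input size. -}

module Defs where

open import Data.Bool.Base using (Bool; true; false)
open import Data.Fin.Base using (Fin; toℕ)
open import Data.Fin.Subset as Subset using (Subset)
open import Data.List.Base using (List; []; _∷_)
open import Data.List.Membership.Propositional using (_∈_)
open import Data.Nat.Base using (ℕ; zero; suc; _+_; _*_; _^_; _≤_)
open import Data.Product.Base using (_×_; _,_; ∃-syntax)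
open import Data.Sum.Base using (_⊎_)
open import Data.Vec.Base using (toList)
open import Function.Bundles using (_⇔_)
open import Relation.Binary.Construct.Closure.Transitive using (TransClosure)
open import Relation.Binary.PropositionalEquality using (_≡_; _≢_)
open import Relation.Nullary.Negation using (¬_)
open import Relation.Unary using (Pred; _≐_; _∩_; _∪_; ∅)

record Implication (n : ℕ) : Set where
  constructor _⟶_
  field
    premise    : Subset n
    conclusion : Fin n

open Implication public

-- Here and below a list stands for the finite set of its members; order
-- and repetitions are irrelevant.
Base : ℕ → Set
Base n = List (Implication n)

Family : ℕ → Set
Family n = List (Subset n)

module _ {n : ℕ} (Σ : Base n) where

  Closed : Pred (Subset n) _
  Closed S = ∀ {i} → i ∈ Σ → premise i Subset.⊈ S ⊎ conclusion i Subset.∈ S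

  Arc : Fin n → Fin n → Set
  Arc x y = ∃[ A ] (A ⟶ y) ∈ Σ × x Subset.∈ A

  Acyclic : Set
  Acyclic = ∀ x → ¬ TransClosure Arc x x

  UnitPremises : Set
  UnitPremises = ∀ {i} → i ∈ Σ → Subset.∣ premise i ∣ ≡ 1

  record MeetIrreducible (M : Subset n) : Set where
    field
      closed      : Closed M
      proper      : M ≢ Subset.⊤
      irreducible : ∀ {C₁ C₂} → Closed C₁ → Closed C₂ →
                    M ≡ C₁ Subset.∩ C₂ → C₁ ≡ M ⊎ C₂ ≡ M

  record Antichain (𝓑 : Family n) : Set where
    field
      closed       : ∀ {B} → B ∈ 𝓑 → Closed B
      incomparable : ∀ {A B} → A ∈ 𝓑 → B ∈ 𝓑 → A Subset.⊆ B → A ≡ B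

  ↓ : Family n → Pred (Subset n) _
  ↓ 𝓑 C = Closed C × ∃[ B ] B ∈ 𝓑 × C Subset.⊆ B

  ↑ : Family n → Pred (Subset n) _
  ↑ 𝓑 C = Closed C × ∃[ B ] B ∈ 𝓑 × B Subset.⊆ C

-- The one-variable WHILE language over binary trees (the
-- language I of N. D. Jones, "Computability and Complexity
-- from a Programming Perspective", 1997), with a conditional added and
-- with nil as the only constant.  Its unit-cost time measure is
-- polynomially equivalent to Turing-machine time: there is no equality
-- test on trees, and since trees can be stored as shared graphs each
-- step allocates a bounded number of cells.

data Tree : Set where
  nil  : Tree
  cons : Tree → Tree → Tree

size : Tree → ℕ
size nil        = 1
size (cons s t) = suc (size s + size t)

data Expr : Set where
  var  : Expr
  nil  : Expr
  cons : Expr → Expr → Expr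
  hd   : Expr → Expr
  tl   : Expr → Expr

head : Tree → Tree
head nil        = nil
head (cons s t) = s

tail : Tree → Tree
tail nil        = nil
tail (cons s t) = t

eval : Expr → Tree → Tree
eval var        d = d
eval nil        d = nil
eval (cons e f) d = cons (eval e d) (eval f d)
eval (hd e)     d = head (eval e d)
eval (tl e)     d = tail (eval e d)

cost : Expr → ℕ
cost var        = 1
cost nil        = 1
cost (cons e f) = suc (cost e + cost f)
cost (hd e)     = suc (cost e)
cost (tl e)     = suc (cost e)

infixr 5 _﹔_
infix  6 if_then_else_ while_loop_

data Command : Set where
  assign        : Expr → Command
  _﹔_           : Command → Command → Command
  if_then_else_ : Expr → Command → Command → Command
  while_loop_   : Expr → Command → Command

infix 4 ⟨_,_⟩⇓_[_]

-- ⟨ p , d ⟩⇓ d′ [ t ]: started with its variable holding d, the command p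
-- halts after t units of time with the variable holding d′.
data ⟨_,_⟩⇓_[_] : Command → Tree → Tree → ℕ → Set where
  assign     : ∀ {e d} → ⟨ assign e , d ⟩⇓ eval e d [ suc (cost e) ]
  seq        : ∀ {p q d d′ d″ t u} →
               ⟨ p , d ⟩⇓ d′ [ t ] → ⟨ q , d′ ⟩⇓ d″ [ u ] →
               ⟨ p ﹔ q , d ⟩⇓ d″ [ suc (t + u) ]
  if-true    : ∀ {e p q d d′ t} → eval e d ≢ nil →
               ⟨ p , d ⟩⇓ d′ [ t ] →
               ⟨ if e then p else q , d ⟩⇓ d′ [ suc (cost e + t) ]
  if-false   : ∀ {e p q d d′ t} → eval e d ≡ nil →
               ⟨ q , d ⟩⇓ d′ [ t ] →
               ⟨ if e then p else q , d ⟩⇓ d′ [ suc (cost e + t) ]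
  while-stop : ∀ {e p d} → eval e d ≡ nil →
               ⟨ while e loop p , d ⟩⇓ d [ suc (cost e) ]
  while-step : ∀ {e p d d′ d″ t u} → eval e d ≢ nil →
               ⟨ p , d ⟩⇓ d′ [ t ] → ⟨ while e loop p , d′ ⟩⇓ d″ [ u ] →
               ⟨ while e loop p , d ⟩⇓ d″ [ suc (cost e + (t + u)) ]

record Problem : Set₁ where
  field
    Instance : Set
    Yes      : Instance → Set
    encode   : Instance → Tree

open Problem

restrict : (P : Problem) → (Instance P → Set) → Problem
restrict P R = record
  { Instance = ∃[ x ] R x
  ; Yes      = λ (x , _) → Yes P x
  ; encode   = λ (x , _) → encode P x
  }

-- The answer is "yes" when the final tree is not nil.  Nothing is required
-- on trees that do not encode an instance.
PolyTime : Problem → Set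
PolyTime P = ∃[ p ] ∃[ c ] ∃[ k ] ∀ (x : Instance P) →
  ∃[ out ] ∃[ t ]
    ⟨ p , encode P x ⟩⇓ out [ t ] ×
    t ≤ c * size (encode P x) ^ k + c ×
    (out ≢ nil ⇔ Yes P x)

-- Numbers are in unary and subsets are characteristic vectors,
-- so the size of an encoded instance is polynomially related to the size
-- of X plus the total size of the sets listed.

encodeℕ : ℕ → Tree
encodeℕ zero    = nil
encodeℕ (suc m) = cons nil (encodeℕ m)

encodeBool : Bool → Tree
encodeBool false = nil
encodeBool true  = cons nil nil

encodeList : {A : Set} → (A → Tree) → List A → Tree
encodeList f []       = nil
encodeList f (x ∷ xs) = cons (f x) (encodeList f xs)

encodeSubset : ∀ {n} → Subset n → Tree
encodeSubset S = encodeList encodeBool (toList S)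

encodeImplication : ∀ {n} → Implication n → Tree
encodeImplication (A ⟶ b) = cons (encodeSubset A) (encodeℕ (toℕ b))

encodeBase : ∀ {n} → Base n → Tree
encodeBase = encodeList encodeImplication

encodeFamily : ∀ {n} → Family n → Tree
encodeFamily = encodeList encodeSubset

record CMI-Instance : Set where
  field
    {n} : ℕ
    Σ   : Base n
    𝓜   : Family n

CMI : Problem
CMI = record
  { Instance = CMI-Instance
  ; Yes      = λ I → let open CMI-Instance I in
                 ∀ M → M ∈ 𝓜 ⇔ MeetIrreducible Σ M
  ; encode   = λ I → let open CMI-Instance I in
                 cons (encodeℕ n) (cons (encodeBase Σ) (encodeFamily 𝓜))
  }

record DUAL-Instance : Set where
  field
    {n}          : ℕ
    Σ            : Base n
    𝓑⁺ 𝓑⁻        : Family n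
    𝓑⁺-antichain : Antichain Σ 𝓑⁺
    𝓑⁻-antichain : Antichain Σ 𝓑⁻

DUAL : Problem
DUAL = record
  { Instance = DUAL-Instance
  ; Yes      = λ I → let open DUAL-Instance I in
                 (↓ Σ 𝓑⁺ ∩ ↑ Σ 𝓑⁻) ≐ ∅ × (↓ Σ 𝓑⁺ ∪ ↑ Σ 𝓑⁻) ≐ Closed Σ
  ; encode   = λ I → let open DUAL-Instance I in
                 cons (encodeℕ n)
                      (cons (encodeBase Σ)
                            (cons (encodeFamily 𝓑⁺) (encodeFamily 𝓑⁻)))
  }

AcyclicCMI : Problem
AcyclicCMI = restrict CMI λ I → Acyclic (CMI-Instance.Σ I)

DistributiveDUAL : Problem
DistributiveDUAL = restrict DUAL λ I → UnitPremises (DUAL-Instance.Σ I)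

{-# OPTIONS --safe #-}

-- Let R be the preorder on X generated by Σ, so that the closed sets are the
-- up-closed sets of R.  Add one point z to X and implications B → z for
-- B ∈ 𝓑⁻.  The closed sets are then the sets S ∪ {z} with S up-closed, and the
-- up-closed S that lie above no member of 𝓑⁻.  Their meet-irreducibles are
-- the {y : not y R x} ∪ {z} for x ∈ X, and the maximal up-closed sets above no
-- member of 𝓑⁻; and DUAL has answer "yes" exactly when 𝓑⁺ is the family of
-- these maximal sets.  To make the base acyclic when R is not antisymmetric,
-- all elements of an equivalence class but the least are put into every closed
-- set by implications with empty premise.  R is computed by adding the
-- implications of Σ one at a time to a table, which keeps it a preorder
-- throughout.

module Submission where

open import Defs
open import Data.Bool.Base using (Bool; true; false; not; _∧_; _∨_; T) renaming
  (if_then_else_ to ifᵇ_then_else_)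
open import Data.Bool.ListAction using (any)
open import Data.Bool.Properties using (T-∧; T-∨; T-≡; T?)
open import Data.Empty using (⊥; ⊥-elim)
open import Data.Fin.Base using (Fin; zero; suc; toℕ)
import Data.Fin.Properties as Fin
open import Data.Fin.Subset using (Subset; inside; outside; ⊤; _⊆_; _⊈_; _⊃_; ⁅_⁆; ∣_∣;
  Nonempty) renaming (_∈_ to _∈ₛ_; _∉_ to _∉ₛ_; _∩_ to _∩ₛ_; _∪_ to _∪ₛ_)
open import Data.Fin.Subset.Induction using (⊃-wellFounded)
open import Data.Fin.Subset.Properties
open import Data.List.Base as List using (List; []; _∷_; _++_; _ʳ++_; [_]; allFin;
  concatMap; filter)
open import Data.List.Membership.Propositional using (_∈_; find; lose)
open import Data.List.Membership.Propositional.Properties using (∈-allFin; ∈-map⁺; ∈-map⁻;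
  ∈-++⁺ˡ; ∈-++⁺ʳ; ∈-++⁻; ∈-concatMap⁺; ∈-concatMap⁻; ∈-map∘filter⁺; ∈-map∘filter⁻)
open import Data.List.Properties using (++-assoc; ++-identityʳ; ++-ʳ++; ʳ++-ʳ++;
  map-tabulate; upTo-∷ʳ)
open import Data.List.Relation.Unary.Any using (Any; here; there; any?)
open import Data.List.Relation.Unary.Any.Properties using (any⁺; any⁻)
open import Data.Nat.Base using (ℕ; zero; suc; _+_; _*_; _^_; _≤_; _<_; _<ᵇ_; z≤n; s≤s; NonZero)
open import Data.Nat.Induction using (<-wellFounded)
open import Data.Nat.Properties
open import Data.Nat.Tactic.RingSolver using (solve-∀)
open import Data.Product.Base using (_×_; _,_; ∃-syntax; proj₁; proj₂)
open import Data.Sum.Base using (_⊎_; inj₁; inj₂; [_,_]′)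
open import Data.Unit.Base using (tt) renaming (⊤ to Unit)
open import Data.Vec.Base as Vec using (Vec; _∷_; toList; lookup; tabulate; here; there)
open import Data.Vec.Properties using (lookup∘tabulate; []=⇒lookup; lookup⇒[]=)
open import Function.Base using (_∘_; id)
open import Function.Bundles using (_⇔_; mk⇔; Equivalence)
open import Function.Construct.Composition using (_⇔-∘_)
open import Function.Construct.Symmetry using (⇔-sym)
open import Induction.WellFounded using (Acc; acc)
open import Relation.Binary.Construct.Closure.Transitive using (TransClosure) renaming
  ([_] to single; _∷_ to _∷⁺_)
open import Relation.Binary.Definitions using (tri<; tri≈; tri>)
open import Relation.Binary.PropositionalEquality using (_≡_; _≢_; refl; sym; trans; cong;
  cong₂; subst; module ≡-Reasoning)
open import Relation.Nullary using (¬_; Dec; yes; no; ¬?; _×-dec_)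
open import Relation.Nullary.Decidable using (⌊_⌋; toWitness; fromWitness; _→-dec_)

-- Of the meet-irreducible sets of the new base only those without z are hard to list: there may be
-- exponentially many maximal sets, while the others number at most n and can be written into the
-- family in advance. Equivalent elements are kept instead of contracted, so that no point of X is
-- merged with another; the implication that forces an element has an empty premise and so adds no
-- arc to the implication graph. Half of the work is to show that the reduction runs in polynomial
-- time in the tree language. Since `cons var var` doubles a tree in constant time, a fast program
-- can produce a tree of exponential size. The table of R meets this condition because each round
-- rebuilds it from normalised bits, so that its size is bounded in terms of n alone.

open Equivalence using (to; from)
open Problem

-- Polynomials

infixl 6 _⊕_
infixl 7 _⊗_

data Polynomial : Set where
  con     : ℕ → Polynomial
  X       : Polynomial
  _⊕_ _⊗_ : Polynomial → Polynomial → Polynomial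

⟪_⟫ : Polynomial → ℕ → ℕ
⟪ con c ⟫ n = c
⟪ X     ⟫ n = n
⟪ p ⊕ q ⟫ n = ⟪ p ⟫ n + ⟪ q ⟫ n
⟪ p ⊗ q ⟫ n = ⟪ p ⟫ n * ⟪ q ⟫ n

⟪⟫-mono : ∀ p {m n} → m ≤ n → ⟪ p ⟫ m ≤ ⟪ p ⟫ n
⟪⟫-mono (con c) m≤n = ≤-refl
⟪⟫-mono X       m≤n = m≤n
⟪⟫-mono (p ⊕ q) m≤n = +-mono-≤ (⟪⟫-mono p m≤n) (⟪⟫-mono q m≤n)
⟪⟫-mono (p ⊗ q) m≤n = *-mono-≤ (⟪⟫-mono p m≤n) (⟪⟫-mono q m≤n)

infixr 8 _⊙_

_⊙_ : Polynomial → Polynomial → Polynomial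
con c   ⊙ r = con c
X       ⊙ r = r
(p ⊕ q) ⊙ r = (p ⊙ r) ⊕ (q ⊙ r)
(p ⊗ q) ⊙ r = (p ⊙ r) ⊗ (q ⊙ r)

⟪⟫-⊙ : ∀ p q n → ⟪ p ⊙ q ⟫ n ≡ ⟪ p ⟫ (⟪ q ⟫ n)
⟪⟫-⊙ (con c) r n = refl
⟪⟫-⊙ X       r n = refl
⟪⟫-⊙ (p ⊕ q) r n = cong₂ _+_ (⟪⟫-⊙ p r n) (⟪⟫-⊙ q r n)
⟪⟫-⊙ (p ⊗ q) r n = cong₂ _*_ (⟪⟫-⊙ p r n) (⟪⟫-⊙ q r n)

≤-⊙ : ∀ p q {m n} → m ≤ ⟪ q ⟫ n → ⟪ p ⟫ m ≤ ⟪ p ⊙ q ⟫ n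
≤-⊙ p q {n = n} m≤ = ≤-trans (⟪⟫-mono p m≤) (≤-reflexive (sym (⟪⟫-⊙ p q n)))

infixr 8 _⊗^_

_⊗^_ : Polynomial → ℕ → Polynomial
p ⊗^ zero  = con 1
p ⊗^ suc k = p ⊗ (p ⊗^ k)

⟪⟫-⊗^ : ∀ p k n → ⟪ p ⊗^ k ⟫ n ≡ ⟪ p ⟫ n ^ k
⟪⟫-⊗^ p zero    n = refl
⟪⟫-⊗^ p (suc k) n = cong (⟪ p ⟫ n *_) (⟪⟫-⊗^ p k n)

-- For a sum, both exponents are raised to `k + l`, which is why `n` has to be positive; sizes of
-- trees are. The result is the shape of bound that `PolyTime` asks for.
monomial-bound : ∀ p → ∃[ c ] ∃[ k ] ∀ n → .{{NonZero n}} → ⟪ p ⟫ n ≤ c * n ^ k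
monomial-bound (con c) = c , 0 , λ n → ≤-reflexive (sym (*-identityʳ c))
monomial-bound X       = 1 , 1 , λ n → ≤-reflexive (sym (trans (*-identityˡ _) (*-identityʳ n)))
monomial-bound (p ⊕ q) =
  let c , k , p≤ = monomial-bound p
      d , l , q≤ = monomial-bound q
  in c + d , k + l , λ n → ≤-trans
       (+-mono-≤ (≤-trans (p≤ n) (*-monoʳ-≤ c (^-monoʳ-≤ n (m≤m+n k l))))
                 (≤-trans (q≤ n) (*-monoʳ-≤ d (^-monoʳ-≤ n (m≤n+m l k)))))
       (≤-reflexive (sym (*-distribʳ-+ (n ^ (k + l)) c d)))
monomial-bound (p ⊗ q) =
  let c , k , p≤ = monomial-bound p
      d , l , q≤ = monomial-bound q
  in c * d , k + l , λ n → ≤-trans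
       (*-mono-≤ (p≤ n) (q≤ n))
       (≤-reflexive (trans ([m*n]*[o*p]≡[m*o]*[n*p] c (n ^ k) d (n ^ l))
                           (cong (c * d *_) (sym (^-distribˡ-+-* n k l)))))

-- Timed runs of programs

size-nonZero : ∀ d → NonZero (size d)
size-nonZero nil        = _
size-nonZero (cons _ _) = _

infix 4 ⟨_,_⟩⇓_≤[_]

⟨_,_⟩⇓_≤[_] : Command → Tree → Tree → ℕ → Set
⟨ p , d ⟩⇓ d′ ≤[ b ] = ∃[ t ] ⟨ p , d ⟩⇓ d′ [ t ] × t ≤ b

weaken : ∀ {p d d′ b c} → b ≤ c → ⟨ p , d ⟩⇓ d′ ≤[ b ] → ⟨ p , d ⟩⇓ d′ ≤[ c ]
weaken b≤c (t , run , t≤b) = t , run , ≤-trans t≤b b≤c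

run-assign : ∀ e d → ⟨ assign e , d ⟩⇓ eval e d ≤[ suc (cost e) ]
run-assign e d = _ , assign , ≤-refl

infixr 5 _then-run_

_then-run_ : ∀ {p q d d′ d″ b c} →
             ⟨ p , d ⟩⇓ d′ ≤[ b ] → ⟨ q , d′ ⟩⇓ d″ ≤[ c ] →
             ⟨ p ﹔ q , d ⟩⇓ d″ ≤[ suc (b + c) ]
(t , r , t≤) then-run (u , s , u≤) = _ , seq r s , s≤s (+-mono-≤ t≤ u≤)

-- A framed program works on the head of its store and keeps the tail.
frameExpr : Expr → Expr
frameExpr var        = hd var
frameExpr nil        = nil
frameExpr (cons e f) = cons (frameExpr e) (frameExpr f)
frameExpr (hd e)     = hd (frameExpr e)
frameExpr (tl e)     = tl (frameExpr e)

frame : Command → Command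
frame (assign e)             = assign (cons (frameExpr e) (tl var))
frame (p ﹔ q)               = frame p ﹔ frame q
frame (if e then p else q)   = if frameExpr e then frame p else frame q
frame (while e loop p)       = while frameExpr e loop frame p

eval-frameExpr : ∀ e d r → eval (frameExpr e) (cons d r) ≡ eval e d
eval-frameExpr var        d r = refl
eval-frameExpr nil        d r = refl
eval-frameExpr (cons e f) d r = cong₂ cons (eval-frameExpr e d r) (eval-frameExpr f d r)
eval-frameExpr (hd e)     d r = cong head (eval-frameExpr e d r)
eval-frameExpr (tl e)     d r = cong tail (eval-frameExpr e d r)

cost-frameExpr : ∀ e → cost (frameExpr e) ≤ 2 * cost e
cost-frameExpr var        = ≤-refl
cost-frameExpr nil        = s≤s z≤n
cost-frameExpr (cons e f) = ≤-trans
  (s≤s (+-mono-≤ (cost-frameExpr e) (cost-frameExpr f)))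
  (≤-trans (n≤1+n _) (≤-reflexive (lemma (cost e) (cost f))))
  where
  lemma : ∀ a b → 2 + (2 * a + 2 * b) ≡ 2 * suc (a + b)
  lemma = solve-∀
cost-frameExpr (hd e) = ≤-trans (s≤s (cost-frameExpr e))
  (≤-trans (n≤1+n _) (≤-reflexive (sym (*-suc 2 (cost e)))))
cost-frameExpr (tl e) = ≤-trans (s≤s (cost-frameExpr e))
  (≤-trans (n≤1+n _) (≤-reflexive (sym (*-suc 2 (cost e)))))

cost-frameExpr′ : ∀ e → cost (frameExpr e) ≤ 4 * cost e
cost-frameExpr′ e = ≤-trans (cost-frameExpr e) (*-monoˡ-≤ (cost e) {2} {4} (s≤s (s≤s z≤n)))

private
  1+4*+ : ∀ {m} a b → m ≤ 4 * a + 4 * b → suc m ≤ 4 * suc (a + b)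
  1+4*+ a b m≤ = ≤-trans (s≤s (≤-trans m≤ (m≤n+m _ 3))) (≤-reflexive (lemma a b))
    where
    lemma : ∀ a b → suc (3 + (4 * a + 4 * b)) ≡ 4 * suc (a + b)
    lemma = solve-∀

-- Framing at most doubles the cost of an expression, and a framed assignment also pays for
-- rebuilding the pair; the factor 4 covers both.
run-frame : ∀ {p d d′ t} r → ⟨ p , d ⟩⇓ d′ [ t ] →
            ⟨ frame p , cons d r ⟩⇓ cons d′ r ≤[ 4 * t ]
run-frame {d = d} r (assign {e}) = weaken
  (≤-trans (s≤s (s≤s (+-monoˡ-≤ 2 (cost-frameExpr e))))
    (≤-trans (m≤m+n _ (2 * cost e)) (≤-reflexive (lemma (cost e)))))
  (subst (λ d′ → ⟨ _ , cons d r ⟩⇓ cons d′ r ≤[ _ ])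
    (eval-frameExpr e d r)
    (run-assign (cons (frameExpr e) (tl var)) (cons d r)))
  where
  lemma : ∀ a → 2 + (2 * a + 2) + 2 * a ≡ 4 * suc a
  lemma = solve-∀
run-frame r (seq {t = t} {u} run₁ run₂) = weaken
  (1+4*+ t u ≤-refl)
  (run-frame r run₁ then-run run-frame r run₂)
run-frame {d = d} r (if-true {e} {t = t} e≢nil run) =
  let _ , run′ , t≤ = run-frame r run
  in _ , if-true (e≢nil ∘ trans (sym (eval-frameExpr e d r))) run′
       , 1+4*+ (cost e) t (+-mono-≤ (cost-frameExpr′ e) t≤)
run-frame {d = d} r (if-false {e} {t = t} e≡nil run) =
  let _ , run′ , t≤ = run-frame r run
  in _ , if-false (trans (eval-frameExpr e d r) e≡nil) run′
       , 1+4*+ (cost e) t (+-mono-≤ (cost-frameExpr′ e) t≤)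
run-frame {d = d} r (while-stop {e} e≡nil) =
  _ , while-stop (trans (eval-frameExpr e d r) e≡nil)
    , ≤-trans (s≤s (≤-trans (cost-frameExpr′ e) (m≤n+m _ 3)))
              (≤-reflexive (sym (*-suc 4 (cost e))))
run-frame {d = d} r (while-step {e} {t = t} {u} e≢nil run₁ run₂) =
  let _ , run₁′ , t≤ = run-frame r run₁
      _ , run₂′ , u≤ = run-frame r run₂
  in _ , while-step (e≢nil ∘ trans (sym (eval-frameExpr e d r))) run₁′ run₂′
       , 1+4*+ (cost e) (t + u)
           (+-mono-≤ (cost-frameExpr′ e)
             (≤-trans (+-mono-≤ t≤ u≤) (≤-reflexive (sym (*-distribˡ-+ 4 t u)))))

run-frame≤ : ∀ {p d d′ b} r → ⟨ p , d ⟩⇓ d′ ≤[ b ] →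
             ⟨ frame p , cons d r ⟩⇓ cons d′ r ≤[ 4 * b ]
run-frame≤ r (t , run , t≤b) = weaken (*-monoʳ-≤ 4 t≤b) (run-frame r run)

-- Polynomial-time functions on trees

-- A composite runs its second program on the output of the first, so that output needs a size bound
-- of its own, which `time` does not supply.
record PolyFun : Set where
  no-eta-equality
  field
    fun     : Tree → Tree
    program : Command
    time    : Polynomial
    space   : Polynomial
    halts   : ∀ d → ⟨ program , d ⟩⇓ fun d ≤[ ⟪ time ⟫ (size d) ]
    bounded : ∀ d → size (fun d) ≤ ⟪ space ⟫ (size d)

open PolyFun

infix 4 _at_yields_

-- A record rather than an equation, so that F and d can be inferred.
record _at_yields_ (F : PolyFun) (d t : Tree) : Set where
  constructor yields
  field
    equation : fun F d ≡ t

open _at_yields_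

spaceExpr : Expr → Polynomial
spaceExpr var        = X
spaceExpr nil        = con 1
spaceExpr (cons e f) = con 1 ⊕ (spaceExpr e ⊕ spaceExpr f)
spaceExpr (hd e)     = spaceExpr e
spaceExpr (tl e)     = spaceExpr e

size-head : ∀ d → size (head d) ≤ size d
size-head nil        = ≤-refl
size-head (cons s t) = m≤n⇒m≤1+n (m≤m+n (size s) (size t))

size-tail : ∀ d → size (tail d) ≤ size d
size-tail nil        = ≤-refl
size-tail (cons s t) = m≤n⇒m≤1+n (m≤n+m (size t) (size s))

size-eval : ∀ e d → size (eval e d) ≤ ⟪ spaceExpr e ⟫ (size d)
size-eval var        d = ≤-refl
size-eval nil        d = ≤-refl
size-eval (cons e f) d = s≤s (+-mono-≤ (size-eval e d) (size-eval f d))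
size-eval (hd e)     d = ≤-trans (size-head (eval e d)) (size-eval e d)
size-eval (tl e)     d = ≤-trans (size-tail (eval e d)) (size-eval e d)

exprF : Expr → PolyFun
exprF e = record
  { fun     = eval e
  ; program = assign e
  ; time    = con (suc (cost e))
  ; space   = spaceExpr e
  ; halts   = run-assign e
  ; bounded = size-eval e
  }

infixr 9 _∘F_

opaque

  _∘F_ : PolyFun → PolyFun → PolyFun
  G ∘F F = record
    { fun     = λ d → fun G (fun F d)
    ; program = program F ﹔ program G
    ; time    = con 1 ⊕ (time F ⊕ time G ⊙ space F)
    ; space   = space G ⊙ space F
    ; halts   = λ d → halts F d then-run
                      weaken (≤-⊙ (time G) (space F) (bounded F d)) (halts G (fun F d))
    ; bounded = λ d → ≤-trans (bounded G (fun F d)) (≤-⊙ (space G) (space F) (bounded F d))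
    }

  ∘F-spec : ∀ {F G d s t} → F at d yields s → G at s yields t → (G ∘F F) at d yields t
  ∘F-spec {G = G} (yields eqF) (yields eqG) = yields (trans (cong (fun G) eqF) eqG)

swap : Expr
swap = cons (tl var) (hd var)

opaque

  pairF : PolyFun → PolyFun → PolyFun
  pairF F G = record
    { fun     = λ d → cons (fun F d) (fun G d)
    ; program = assign (cons var var) ﹔ frame (program F) ﹔ assign swap ﹔
                frame (program G) ﹔ assign swap
    -- 4 and 6 are the times for assigning `cons var var` and `swap`, each 1 pays for a sequencing,
    -- and the factor 4 is that of `run-frame`.
    ; time    = con 1 ⊕ (con 4 ⊕ (con 1 ⊕ (con 4 ⊗ time F ⊕ (con 1 ⊕ (con 6 ⊕
                  (con 1 ⊕ (con 4 ⊗ time G ⊕ con 6)))))))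
    ; space   = con 1 ⊕ (space F ⊕ space G)
    ; halts   = λ d →
        run-assign (cons var var) d then-run
        run-frame≤ d (halts F d) then-run
        run-assign swap (cons (fun F d) d) then-run
        run-frame≤ (fun F d) (halts G d) then-run
        run-assign swap (cons (fun G d) (fun F d))
    ; bounded = λ d → s≤s (+-mono-≤ (bounded F d) (bounded G d))
    }

  pairF-spec : ∀ {F G d s t} → F at d yields s → G at d yields t →
               pairF F G at d yields cons s t
  pairF-spec (yields eqF) (yields eqG) = yields (cong₂ cons eqF eqG)

ifT_then_else_ : Tree → Tree → Tree → Tree
ifT nil        then s else t = t
ifT (cons _ _) then s else t = s

opaque
  unfolding pairF

  ifF_then_else_ : PolyFun → PolyFun → PolyFun → PolyFun
  ifF B then F else G = record
    { fun     = λ d → ifT fun B d then fun F d else fun G d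
    ; program = program test ﹔
                if hd var then assign (tl var) ﹔ program F else (assign (tl var) ﹔ program G)
    ; time    = con 1 ⊕ (time test ⊕ (con 3 ⊕ (con 4 ⊕ (time F ⊕ time G))))
    ; space   = space F ⊕ space G
    ; halts   = λ d → halts test d then-run branch d (fun B d)
    ; bounded = λ d → size-if (fun B d) d
    }
    where
    test : PolyFun
    test = pairF B (exprF var)
    size-if : ∀ b d → size (ifT b then fun F d else fun G d) ≤ ⟪ space F ⊕ space G ⟫ (size d)
    size-if nil        d = ≤-trans (bounded G d) (m≤n+m _ _)
    size-if (cons _ _) d = ≤-trans (bounded F d) (m≤m+n _ _)
    branch : ∀ d b → ⟨ if hd var then assign (tl var) ﹔ program F else (assign (tl var) ﹔ program G)
                     , cons b d ⟩⇓ ifT b then fun F d else fun G d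
                     ≤[ 3 + (4 + (⟪ time F ⟫ (size d) + ⟪ time G ⟫ (size d))) ]
    branch d nil =
      let _ , run , t≤ = run-assign (tl var) (cons nil d) then-run halts G d
      in _ , if-false refl run
           , s≤s (s≤s (s≤s (≤-trans t≤ (+-monoʳ-≤ 4 (m≤n+m _ _)))))
    branch d (cons b c) =
      let _ , run , t≤ = run-assign (tl var) (cons (cons b c) d) then-run halts F d
      in _ , if-true (λ ()) run
           , s≤s (s≤s (s≤s (≤-trans t≤ (+-monoʳ-≤ 4 (m≤m+n _ _)))))

  ifF-equation : ∀ B F G d → fun (ifF B then F else G) d ≡ ifT fun B d then fun F d else fun G d
  ifF-equation B F G d = refl

  ifF-spec : ∀ {B F G} {A : Set} {e : A → Tree} {d b x y} →
             B at d yields encodeBool b → F at d yields e x → G at d yields e y →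
             ifF B then F else G at d yields e (ifᵇ b then x else y)
  ifF-spec {b = true}  (yields eq) (yields eqF) eqG = yields (trans (cong (ifT_then _ else _) eq) eqF)
  ifF-spec {b = false} (yields eq) eqF (yields eqG) = yields (trans (cong (ifT_then _ else _) eq) eqG)

-- The step sees the whole remaining list, not only its first element.
foldT : (Tree → Tree → Tree) → Tree → Tree → Tree
foldT f a nil         = a
foldT f a (cons x xs) = foldT f (f (cons x xs) a) xs

-- Accumulators that grow additively, by an amount independent of the
-- accumulator, stay polynomially bounded.
Growth : PolyFun → Polynomial → Set
Growth F g = ∀ l a d →
  size (fun F (cons l (cons a d))) ≤ size a + ⟪ g ⟫ (size l + size d)

module Fold (F : PolyFun) (g : Polynomial) (growth : Growth F g) where

  -- The store is `cons l (cons a d)`. `before` puts a full copy of it, for the step to consume, in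
  -- front of the remaining list and `d`; `after` moves the new accumulator back between these two.
  before after loop : Command
  before = assign (cons var (cons (tl (hd var)) (tl (tl var))))
  after  = assign (cons (hd (tl var)) (cons (hd var) (tl (tl var))))
  loop   = while hd var loop (before ﹔ frame (program F) ﹔ after)

  step : Tree → Tree → Tree → Tree
  step d l a = fun F (cons l (cons a d))

  module _ (d : Tree) (N A : ℕ) where

    increment : ℕ
    increment = ⟪ g ⟫ (N + size d)

    stateSize : ℕ
    stateSize = suc (N + suc (A + size d))

    bodyTime : ℕ
    -- 10 and 11 are the times of the assignments `before` and `after`.
    bodyTime = 1 + (10 + (1 + (4 * ⟪ time F ⟫ stateSize + 11)))

    run-body : ∀ x xs a → size (cons x xs) ≤ N → size a ≤ A →
      ⟨ before ﹔ frame (program F) ﹔ after , cons (cons x xs) (cons a d) ⟩⇓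
      cons xs (cons (step d (cons x xs) a) d) ≤[ bodyTime ]
    run-body x xs a l≤N a≤A =
      run-assign _ _ then-run
      weaken (*-monoʳ-≤ 4 (⟪⟫-mono (time F) (s≤s (+-mono-≤ l≤N (s≤s (+-monoˡ-≤ (size d) a≤A))))))
        (run-frame≤ (cons xs d) (halts F (cons (cons x xs) (cons a d)))) then-run
      run-assign _ _

    -- `size a + size l * increment` is a potential that no step raises: the accumulator gains at
    -- most `increment` while the list loses at least 1 in size. With `A` bounding it at the start,
    -- the single bound `bodyTime` serves all rounds.
    step-bound : ∀ x xs a → size (cons x xs) ≤ N → size a + size (cons x xs) * increment ≤ A →
                 size (step d (cons x xs) a) + size xs * increment ≤ A
    step-bound x xs a l≤N a≤A = ≤-trans
      (+-monoˡ-≤ (size xs * increment)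
        (≤-trans (growth (cons x xs) a d)
                 (+-monoʳ-≤ (size a) (⟪⟫-mono g (+-monoˡ-≤ (size d) l≤N)))))
      (≤-trans (≤-reflexive (+-assoc (size a) increment (size xs * increment)))
      (≤-trans (+-monoʳ-≤ (size a)
                 (*-monoˡ-≤ increment (s≤s (m≤n+m (size xs) (size x)))))
               a≤A))

    run-loop : ∀ l a → size l ≤ N → size a + size l * increment ≤ A →
      ⟨ loop , cons l (cons a d) ⟩⇓ cons nil (cons (foldT (step d) a l) d)
      ≤[ size l * (3 + bodyTime) ]
    run-loop nil a l≤N a≤A = _ , while-stop refl , m≤m+n 3 _
    run-loop (cons x xs) a l≤N a≤A =
      let _ , run  , t≤ = run-body x xs a l≤N (≤-trans (m≤m+n _ _) a≤A)
          _ , run′ , u≤ = run-loop xs (step d (cons x xs) a)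
                            (≤-trans (m≤n⇒m≤1+n (m≤n+m _ _)) l≤N)
                            (step-bound x xs a l≤N a≤A)
      in _ , while-step (λ ()) run run′
           , ≤-trans (+-monoʳ-≤ 3 (+-mono-≤ t≤ u≤))
             (≤-trans (≤-reflexive (sym (+-assoc 3 bodyTime _)))
                      (*-monoˡ-≤ (3 + bodyTime) (s≤s (m≤n+m (size xs) (size x)))))

    size-fold : ∀ l a → size l ≤ N → size a + size l * increment ≤ A →
                size (foldT (step d) a l) ≤ A
    size-fold nil         a l≤N a≤A = ≤-trans (m≤m+n _ _) a≤A
    size-fold (cons x xs) a l≤N a≤A =
      size-fold xs (step d (cons x xs) a)
        (≤-trans (m≤n⇒m≤1+n (m≤n+m _ _)) l≤N)
        (step-bound x xs a l≤N a≤A)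

  module _ (I L : PolyFun) where

    start : PolyFun
    start = pairF L (pairF I (exprF var))

    sizeBound loopTime : Polynomial
    sizeBound = space I ⊕ space L ⊗ g ⊙ (space L ⊕ X)
    loopTime  = space L ⊗ (con 3 ⊕ (con 1 ⊕ (con 10 ⊕ (con 1 ⊕
                  (con 4 ⊗ time F ⊙ (con 1 ⊕ (space L ⊕ (con 1 ⊕ (sizeBound ⊕ X)))) ⊕ con 11)))))

    init-bound : ∀ d → let N = ⟪ space L ⟫ (size d) in
      size (fun I d) + size (fun L d) * ⟪ g ⟫ (N + size d) ≤ ⟪ sizeBound ⟫ (size d)
    init-bound d = +-mono-≤ (bounded I d)
      (*-mono-≤ (bounded L d) (≤-⊙ g (space L ⊕ X) ≤-refl))

    opaque
      unfolding pairF

      foldF : PolyFun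
      foldF = record
        { fun     = λ d → foldT (step d) (fun I d) (fun L d)
        ; program = program start ﹔ loop ﹔ assign (hd (tl var))
        ; time    = con 1 ⊕ (time start ⊕ (con 1 ⊕ (loopTime ⊕ con 4)))
        ; space   = sizeBound
        ; halts   = λ d → let N = ⟪ space L ⟫ (size d) ; A = ⟪ sizeBound ⟫ (size d) in
            halts start d then-run
            weaken
              (*-mono-≤ (bounded L d) (+-monoʳ-≤ 3 (+-monoʳ-≤ 12 (+-monoˡ-≤ 11 (*-monoʳ-≤ 4
                (≤-⊙ (time F) (con 1 ⊕ (space L ⊕ (con 1 ⊕ (sizeBound ⊕ X)))) ≤-refl))))))
              (run-loop d N A (fun L d) (fun I d) (bounded L d) (init-bound d)) then-run
            run-assign (hd (tl var)) (cons nil (cons (foldT (step d) (fun I d) (fun L d)) d))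
        ; bounded = λ d →
            size-fold d (⟪ space L ⟫ (size d)) (⟪ sizeBound ⟫ (size d))
              (fun L d) (fun I d) (bounded L d) (init-bound d)
        }

      foldF-equation : ∀ d → fun foldF d ≡ foldT (step d) (fun I d) (fun L d)
      foldF-equation d = refl

open Fold using (foldF; foldF-equation) public

-- Programs on encoded Booleans, lists and vectors

nilF trueF : PolyFun
nilF  = exprF nil
trueF = exprF (cons nil nil)

drop : ℕ → Expr
drop zero    = var
drop (suc k) = tl (drop k)

-- De Bruijn reference into an environment cons x₀ (cons x₁ …).
ref : ℕ → PolyFun
ref k = exprF (hd (drop k))

opaque

  boolF : PolyFun → PolyFun
  boolF P = ifF P then trueF else nilF

  boolF-equation : ∀ P d → fun (boolF P) d ≡ ifT fun P d then cons nil nil else nil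
  boolF-equation P d = ifF-equation P trueF nilF d

  boolF-spec : ∀ {P d p} → P at d yields encodeBool p → boolF P at d yields encodeBool p
  boolF-spec {p = true}  eq = ifF-spec {e = encodeBool} {x = true} {y = false} eq (yields refl) (yields refl)
  boolF-spec {p = false} eq = ifF-spec {e = encodeBool} {x = true} {y = false} eq (yields refl) (yields refl)

opaque

  notF : PolyFun → PolyFun
  notF P = ifF P then nilF else trueF

  notF-spec : ∀ {P d p} → P at d yields encodeBool p → notF P at d yields encodeBool (not p)
  notF-spec {p = true}  eq = ifF-spec {e = encodeBool} {x = false} {y = true} eq (yields refl) (yields refl)
  notF-spec {p = false} eq = ifF-spec {e = encodeBool} {x = false} {y = true} eq (yields refl) (yields refl)

opaque

  andF : PolyFun → PolyFun → PolyFun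
  andF P Q = ifF P then boolF Q else nilF

  andF-spec : ∀ {P Q d p q} → P at d yields encodeBool p → Q at d yields encodeBool q →
              andF P Q at d yields encodeBool (p ∧ q)
  andF-spec {p = true}  {q} eqP eqQ = ifF-spec {e = encodeBool} {y = false} eqP (boolF-spec eqQ) (yields refl)
  andF-spec {p = false} {q} eqP eqQ = ifF-spec {e = encodeBool} {y = false} eqP (boolF-spec eqQ) (yields refl)

opaque

  orF : PolyFun → PolyFun → PolyFun
  orF P Q = ifF P then trueF else boolF Q

  orF-spec : ∀ {P Q d p q} → P at d yields encodeBool p → Q at d yields encodeBool q →
             orF P Q at d yields encodeBool (p ∨ q)
  orF-spec {p = true}  eqP eqQ = ifF-spec {e = encodeBool} {x = true} eqP (yields refl) (boolF-spec eqQ)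
  orF-spec {p = false} eqP eqQ = ifF-spec {e = encodeBool} {x = true} eqP (yields refl) (boolF-spec eqQ)

  -- True of every tree, not only of encodings, because `boolF` normalises the second disjunct; 3 is
  -- the size of `cons nil nil`. This bounds the entries of a new table whatever the old table is.
  size-orF : ∀ P Q d → size (fun (orF P Q) d) ≤ 3
  size-orF P Q d = ≤-trans (≤-reflexive (cong size (ifF-equation P trueF (boolF Q) d)))
    (size-if (fun P d) ≤-refl (≤-trans (≤-reflexive (cong size (boolF-equation Q d)))
                                       (size-if (fun Q d) ≤-refl (s≤s z≤n))))
    where
    size-if : ∀ b {s t k} → size s ≤ k → size t ≤ k → size (ifT b then s else t) ≤ k
    size-if nil        s≤ t≤ = t≤
    size-if (cons _ _) s≤ t≤ = s≤

dropT : Tree → Tree → Tree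
dropT = foldT (λ _ → tail)

opaque

  dropF : PolyFun → PolyFun → PolyFun
  dropF L J = foldF (exprF (tl (hd (tl var)))) (con 0)
    (λ _ a _ → ≤-trans (size-tail a) (m≤m+n _ 0)) L J

  dropF-spec : ∀ {L J d s t} → L at d yields s → J at d yields t →
               dropF L J at d yields dropT s t
  dropF-spec {L} {J} {d} (yields eqL) (yields eqJ) =
    yields (trans (foldF-equation _ _ _ L J d) (cong₂ dropT eqL eqJ))

nthT-spec : ∀ {A : Set} (e : A → Tree) {n} (xs : Vec A n) i →
            head (dropT (encodeList e (toList xs)) (encodeℕ (toℕ i))) ≡ e (lookup xs i)
nthT-spec e (x Vec.∷ xs) zero    = refl
nthT-spec e (x Vec.∷ xs) (suc i) = nthT-spec e xs i

opaque

  nthF : PolyFun → PolyFun → PolyFun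
  nthF L J = exprF (hd var) ∘F dropF L J

  nthF-spec : ∀ {A : Set} (e : A → Tree) {n} (xs : Vec A n) i {L J d} →
              L at d yields encodeList e (toList xs) → J at d yields encodeℕ (toℕ i) →
              nthF L J at d yields e (lookup xs i)
  nthF-spec e xs i eqL eqJ = ∘F-spec (dropF-spec eqL eqJ) (yields (nthT-spec e xs i))

dropT-nil : ∀ i → dropT nil (encodeℕ i) ≡ nil
dropT-nil zero    = refl
dropT-nil (suc i) = dropT-nil i

-- In the absence of a test on trees other than for `nil`, `i` is compared with `j` by dropping `i`
-- elements from the numeral `j`, read as a list, and asking whether anything is left.
ltT-spec : ∀ i j → (ifT dropT (encodeℕ j) (encodeℕ i) then cons nil nil else nil)
                   ≡ encodeBool (i <ᵇ j)
ltT-spec zero    zero    = refl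
ltT-spec zero    (suc j) = refl
ltT-spec (suc i) zero    = cong (ifT_then cons nil nil else nil) (dropT-nil i)
ltT-spec (suc i) (suc j) = ltT-spec i j

opaque

  ltF : PolyFun → PolyFun → PolyFun
  ltF I J = boolF (dropF J I)

  ltF-spec : ∀ i j {I J d} → I at d yields encodeℕ i → J at d yields encodeℕ j →
             ltF I J at d yields encodeBool (i <ᵇ j)
  ltF-spec i j {I} {J} {d} eqI eqJ = yields (trans (boolF-equation (dropF J I) d)
    (trans (cong (ifT_then cons nil nil else nil) (equation (dropF-spec eqJ eqI))) (ltT-spec i j)))

-- List functions as folds

foldT-encodeList : ∀ {A B : Set} (e : A → Tree) (E : B → Tree) {f : Tree → Tree → Tree}
                   (h : B → A → B) →
                   (∀ x t b → f (cons (e x) t) (E b) ≡ E (h b x)) →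
                   ∀ b xs → foldT f (E b) (encodeList e xs) ≡ E (List.foldl h b xs)
foldT-encodeList e E h step b []       = refl
foldT-encodeList e E {f} h step b (x ∷ xs) = trans
  (cong (λ a → foldT f a (encodeList e xs)) (step x (encodeList e xs) b))
  (foldT-encodeList e E h step (h b x) xs)

size-foldT : ∀ {f : Tree → Tree → Tree} {c} → (∀ l a → size (f l a) ≤ size a + c) →
             ∀ a l → size (foldT f a l) ≤ size a + size l * c
size-foldT f≤ a nil = m≤m+n _ _
size-foldT {f} {c} f≤ a (cons x xs) = ≤-trans
  (size-foldT f≤ (f (cons x xs) a) xs)
  (≤-trans (+-monoˡ-≤ (size xs * c) (f≤ (cons x xs) a))
  (≤-trans (≤-reflexive (+-assoc (size a) c (size xs * c)))
    (+-monoʳ-≤ (size a) (*-monoˡ-≤ c (s≤s (m≤n+m (size xs) (size x)))))))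

foldF-spec : ∀ {A B : Set} (e : A → Tree) (E : B → Tree) (h : B → A → B) {F g growth I L d b xs} →
             I at d yields E b → L at d yields encodeList e xs →
             (∀ x t b → F at cons (cons (e x) t) (cons (E b) d) yields E (h b x)) →
             foldF F g growth I L at d yields E (List.foldl h b xs)
foldF-spec e E h {F} {g} {growth} {I} {L} {d} {b} {xs} (yields eqI) (yields eqL) eqF = yields (trans
  (foldF-equation F g growth I L d)
  (trans (cong₂ (foldT _) eqI eqL)
         (foldT-encodeList e E h (λ x t b → equation (eqF x t b)) b xs)))

revAppendT : Tree → Tree → Tree
revAppendT s t = foldT (λ l a → cons (head l) a) t s

size-revAppendT : ∀ s t → size (revAppendT s t) ≤ size s + size t
size-revAppendT nil        t = n≤1+n (size t)
size-revAppendT (cons x s) t = ≤-trans (size-revAppendT s (cons x t))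
  (≤-reflexive (lemma (size x) (size s) (size t)))
  where
  lemma : ∀ a b c → b + suc (a + c) ≡ suc (a + b) + c
  lemma = solve-∀

opaque

  revAppendF : PolyFun → PolyFun → PolyFun
  revAppendF S T = foldF (exprF (cons (hd (hd var)) (hd (tl var)))) (con 1 ⊕ X) growth T S
    where
    growth : Growth (exprF (cons (hd (hd var)) (hd (tl var)))) (con 1 ⊕ X)
    growth l a d = ≤-trans
      (s≤s (≤-trans (+-monoˡ-≤ (size a) (≤-trans (size-head l) (m≤m+n _ (size d))))
                    (≤-reflexive (+-comm _ (size a)))))
      (≤-reflexive (sym (+-suc (size a) _)))

  revAppendF-equation : ∀ S T d → fun (revAppendF S T) d ≡ revAppendT (fun S d) (fun T d)
  revAppendF-equation S T d = foldF-equation _ _ _ T S d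

  revAppendF-spec : ∀ {A : Set} (e : A → Tree) {S T xs ys d} →
                    S at d yields encodeList e xs → T at d yields encodeList e ys →
                    revAppendF S T at d yields encodeList e (xs ʳ++ ys)
  revAppendF-spec e eqS eqT =
    foldF-spec e (encodeList e) (λ b x → x ∷ b) eqT eqS (λ _ _ _ → yields refl)

opaque

  appendF : PolyFun → PolyFun → PolyFun
  appendF S T = revAppendF (revAppendF S nilF) T

  appendF-spec : ∀ {A : Set} (e : A → Tree) {S T xs ys d} →
                 S at d yields encodeList e xs → T at d yields encodeList e ys →
                 appendF S T at d yields encodeList e (xs ++ ys)
  appendF-spec e {S} {T} {xs} {ys} {d} eqS eqT =
    subst (λ zs → revAppendF (revAppendF S nilF) T at d yields encodeList e zs) (ʳ++-ʳ++ xs)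
      (revAppendF-spec e (revAppendF-spec e {ys = []} eqS (yields refl)) eqT)

-- A fold pushes onto the front of its accumulator, so `concatMapF` collects its output backwards
-- and reverses it once at the end.
foldl-ʳ++ : ∀ {A B : Set} (g : A → List B) ys xs →
            List.foldl (λ b x → g x ʳ++ b) ys xs ≡ concatMap g xs ʳ++ ys
foldl-ʳ++ g ys []       = refl
foldl-ʳ++ g ys (x ∷ xs) = trans (foldl-ʳ++ g (g x ʳ++ ys) xs) (sym (++-ʳ++ (g x)))

opaque

  prependF : PolyFun → PolyFun
  prependF F = revAppendF (F ∘F exprF (cons (hd (hd var)) (tl (tl var)))) (exprF (hd (tl var)))

  prependF-equation : ∀ F l a d → fun (prependF F) (cons l (cons a d)) ≡
                                  revAppendT (fun F (cons (head l) d)) a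
  prependF-equation F l a d = trans (revAppendF-equation _ _ _)
    (cong (λ t → revAppendT t a) (equation (∘F-spec (yields refl) (yields refl))))

  prependF-growth : ∀ F → Growth (prependF F) (space F ⊙ (con 1 ⊕ X))
  prependF-growth F l a d = ≤-trans
    (≤-reflexive (cong size (prependF-equation F l a d)))
    (≤-trans (size-revAppendT (fun F (cons (head l) d)) a)
      (≤-trans (≤-reflexive (+-comm _ (size a)))
        (+-monoʳ-≤ (size a) (≤-trans (bounded F (cons (head l) d))
          (≤-⊙ (space F) (con 1 ⊕ X) (s≤s (+-monoˡ-≤ (size d) (size-head l))))))))

  prependF-spec : ∀ {B : Set} (e : B → Tree) {F l d ys xs} → F at cons (head l) d yields encodeList e ys →
                  prependF F at cons l (cons (encodeList e xs) d) yields encodeList e (ys ʳ++ xs)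
  prependF-spec e (yields eqF) = revAppendF-spec e (∘F-spec (yields refl) (yields eqF)) (yields refl)

opaque

  concatMapF : PolyFun → PolyFun → PolyFun
  concatMapF F L = revAppendF
    (foldF (prependF F) (space F ⊙ (con 1 ⊕ X)) (prependF-growth F) nilF L) nilF

  concatMapF-spec : ∀ {A B : Set} (e : A → Tree) (e′ : B → Tree) {g : A → List B} {F L xs d} →
                    L at d yields encodeList e xs →
                    (∀ x → F at cons (e x) d yields encodeList e′ (g x)) →
                    concatMapF F L at d yields encodeList e′ (concatMap g xs)
  concatMapF-spec e e′ {g} {F} {L} {xs} {d} eqL eqF =
    subst (λ zs → concatMapF F L at d yields encodeList e′ zs)
      (trans (cong (_ʳ++ []) (foldl-ʳ++ g [] xs))
        (trans (ʳ++-ʳ++ (concatMap g xs)) (++-identityʳ _)))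
      (revAppendF-spec e′ {ys = []}
        (foldF-spec e (encodeList e′) (λ b x → g x ʳ++ b) {b = []} (yields refl) eqL
          (λ x t b → prependF-spec e′ (eqF x)))
        (yields refl))

concatMap-singleton : ∀ {A B : Set} (g : A → B) xs → concatMap ([_] ∘ g) xs ≡ List.map g xs
concatMap-singleton g []       = refl
concatMap-singleton g (x ∷ xs) = cong (g x ∷_) (concatMap-singleton g xs)

opaque
  unfolding concatMapF

  mapF : PolyFun → PolyFun → PolyFun
  mapF F L = concatMapF (pairF F nilF) L

  mapF-spec : ∀ {A B : Set} (e : A → Tree) (e′ : B → Tree) {g : A → B} {F L xs d} →
              L at d yields encodeList e xs →
              (∀ x → F at cons (e x) d yields e′ (g x)) →
              mapF F L at d yields encodeList e′ (List.map g xs)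
  mapF-spec e e′ {g} {F} {L} {xs} {d} eqL eqF =
    subst (λ zs → concatMapF (pairF F nilF) L at d yields encodeList e′ zs) (concatMap-singleton g xs)
      (concatMapF-spec e e′ eqL (λ x → pairF-spec (eqF x) (yields refl)))

  size-mapF : ∀ F L {k} d → (∀ x → size (fun F (cons x d)) ≤ k) →
              size (fun (mapF F L) d) ≤ (1 + size (fun L d) * suc k) + 1
  size-mapF F L {k} d F≤ = ≤-trans (≤-reflexive (cong size (revAppendF-equation _ nilF d)))
    (≤-trans (size-revAppendT _ nil)
      (+-monoˡ-≤ 1 (≤-trans (≤-reflexive (cong size (foldF-equation _ _ _ nilF L d)))
        (size-foldT step≤ nil (fun L d)))))
    where
    step≤ : ∀ l a → size (fun (prependF (pairF F nilF)) (cons l (cons a d))) ≤ size a + suc k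
    step≤ l a = ≤-trans
      (≤-reflexive (cong size (trans (prependF-equation (pairF F nilF) l a d)
        (cong (λ t → revAppendT t a) (equation (pairF-spec (yields refl) (yields refl)))))))
      (≤-trans (s≤s (+-monoˡ-≤ (size a) (F≤ (head l)))) (≤-reflexive (+-comm (suc k) (size a))))

any-concatMap : ∀ {A : Set} (p : A → Bool) xs →
  (ifT encodeList id (concatMap (λ x → ifᵇ p x then [ nil ] else []) xs) then cons nil nil else nil)
  ≡ encodeBool (any p xs)
any-concatMap p []       = refl
any-concatMap p (x ∷ xs) with p x
... | true  = refl
... | false = any-concatMap p xs

opaque

  -- `cons nil nil` encodes both `true` and the one-element list of `nil`. Hence `boolF P` can be
  -- read as producing a list of hits, and the answer is whether the concatenation of these lists is
  -- nonempty.
  anyF : PolyFun → PolyFun → PolyFun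
  anyF P L = boolF (concatMapF (boolF P) L)

  anyF-spec : ∀ {A : Set} (e : A → Tree) {p : A → Bool} {P L xs d} →
              L at d yields encodeList e xs →
              (∀ x → P at cons (e x) d yields encodeBool (p x)) →
              anyF P L at d yields encodeBool (any p xs)
  anyF-spec e {p} {P} {L} {xs} {d} eqL eqP = yields (trans
    (boolF-equation (concatMapF (boolF P) L) d)
    (trans (cong (ifT_then cons nil nil else nil) (equation (concatMapF-spec e id eqL found)))
           (any-concatMap p xs)))
    where
    found : ∀ x → boolF P at cons (e x) d yields encodeList id (ifᵇ p x then [ nil ] else [])
    found x with p x | eqP x
    ... | true  | eq = boolF-spec {p = true} eq
    ... | false | eq = boolF-spec {p = false} eq

-- A unary numeral is a list of `nil`s whose proper tails are the smaller numerals in descending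
-- order; pushing them one by one leaves them ascending.
rangeT : Tree → Tree
rangeT = foldT (λ l a → cons (tail l) a) nil

encodeFin : ∀ {n} → Fin n → Tree
encodeFin i = encodeℕ (toℕ i)

rangeT-spec : ∀ n → rangeT (encodeℕ n) ≡ encodeList encodeFin (allFin n)
rangeT-spec n = begin
  foldT f nil (encodeℕ n)                   ≡⟨ go n [] ⟩
  encodeList encodeℕ (List.upTo n ++ [])    ≡⟨ cong (encodeList encodeℕ) (++-identityʳ _) ⟩
  encodeList encodeℕ (List.upTo n)          ≡⟨ cong (encodeList encodeℕ) (upTo≡ n id) ⟩
  encodeList encodeℕ (List.tabulate toℕ)    ≡⟨ encode-tabulate toℕ id (λ _ → refl) ⟩
  encodeList encodeFin (allFin n)           ∎
  where
  open ≡-Reasoning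
  f : Tree → Tree → Tree
  f l a = cons (tail l) a
  go : ∀ n xs → foldT f (encodeList encodeℕ xs) (encodeℕ n) ≡ encodeList encodeℕ (List.upTo n ++ xs)
  go zero    xs = refl
  go (suc n) xs = trans (go n (n ∷ xs)) (cong (encodeList encodeℕ)
    (trans (sym (++-assoc (List.upTo n) [ n ] xs)) (cong (_++ xs) (upTo-∷ʳ n))))
  upTo≡ : ∀ n (g : ℕ → ℕ) → List.applyUpTo g n ≡ List.tabulate {n = n} (g ∘ toℕ)
  upTo≡ zero    g = refl
  upTo≡ (suc n) g = cong (g 0 ∷_) (upTo≡ n (g ∘ suc))
  encode-tabulate : ∀ {m n} (g : Fin m → ℕ) (h : Fin m → Fin n) → (∀ i → g i ≡ toℕ (h i)) →
                    encodeList encodeℕ (List.tabulate g) ≡ encodeList encodeFin (List.tabulate h)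
  encode-tabulate {zero}  g h eq = refl
  encode-tabulate {suc m} g h eq =
    cong₂ cons (cong encodeℕ (eq zero)) (encode-tabulate (g ∘ suc) (h ∘ suc) (eq ∘ suc))

opaque

  rangeF : PolyFun → PolyFun
  rangeF N = foldF (exprF (cons (tl (hd var)) (hd (tl var)))) (con 1 ⊕ X) growth nilF N
    where
    growth : Growth (exprF (cons (tl (hd var)) (hd (tl var)))) (con 1 ⊕ X)
    growth l a d = ≤-trans
      (s≤s (≤-trans (+-monoˡ-≤ (size a) (≤-trans (size-tail l) (m≤m+n _ (size d))))
                    (≤-reflexive (+-comm _ (size a)))))
      (≤-reflexive (sym (+-suc (size a) _)))

  rangeF-equation : ∀ N d → fun (rangeF N) d ≡ rangeT (fun N d)
  rangeF-equation N d = foldF-equation _ _ _ nilF N d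

  rangeF-spec : ∀ {N n d} → N at d yields encodeℕ n →
                rangeF N at d yields encodeList encodeFin (allFin n)
  rangeF-spec {N} {n} {d} (yields eq) =
    yields (trans (rangeF-equation N d) (trans (cong rangeT eq) (rangeT-spec n)))

rangeSpace : Polynomial
rangeSpace = space (rangeF (exprF var))

size-rangeT : ∀ t → size (rangeT t) ≤ ⟪ rangeSpace ⟫ (size t)
size-rangeT t = subst (λ r → size r ≤ ⟪ rangeSpace ⟫ (size t))
  (rangeF-equation (exprF var) t) (bounded (rangeF (exprF var)) t)

toList-tabulate : ∀ {A : Set} {n} (f : Fin n → A) → toList (Vec.tabulate f) ≡ List.tabulate f
toList-tabulate {n = zero}  f = refl
toList-tabulate {n = suc n} f = cong (f zero ∷_) (toList-tabulate (f ∘ suc))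

tabulateSpace : Polynomial → Polynomial
tabulateSpace q = (con 1 ⊕ rangeSpace ⊗ (con 1 ⊕ q)) ⊕ con 1

opaque

  tabulateF : PolyFun → PolyFun → PolyFun
  tabulateF F N = mapF F (rangeF N)

  tabulateF-spec : ∀ {A : Set} (e : A → Tree) {F N n} {f : Fin n → A} {d} →
                   N at d yields encodeℕ n →
                   (∀ i → F at cons (encodeFin i) d yields e (f i)) →
                   tabulateF F N at d yields encodeList e (toList (Vec.tabulate f))
  tabulateF-spec e {F} {N} {f = f} {d} eqN eqF =
    subst (λ zs → mapF F (rangeF N) at d yields encodeList e zs)
      (trans (map-tabulate id f) (sym (toList-tabulate f)))
      (mapF-spec encodeFin e (rangeF-spec eqN) eqF)

  -- The field `space` measures the output against the whole environment, which inside a fold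
  -- contains the accumulator. This bound depends only on the numeral and on the entries, as
  -- `Growth` requires.
  size-tabulateF : ∀ F N q {d m} → size (fun N d) ≤ m →
                   (∀ x → size (fun F (cons x d)) ≤ ⟪ q ⟫ m) →
                   size (fun (tabulateF F N) d) ≤ ⟪ tabulateSpace q ⟫ m
  size-tabulateF F N q {d} {m} N≤ F≤ = ≤-trans (size-mapF F (rangeF N) d F≤)
    (+-monoˡ-≤ 1 (s≤s (*-monoˡ-≤ (suc (⟪ q ⟫ m))
      (≤-trans (≤-reflexive (cong size (rangeF-equation N d)))
        (≤-trans (size-rangeT (fun N d)) (⟪⟫-mono rangeSpace N≤))))))

-- Closed sets and meet-irreducible sets

T-not⁺ : ∀ {b} → ¬ T b → T (not b)
T-not⁺ {true}  ¬t = ⊥-elim (¬t tt)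
T-not⁺ {false} ¬t = tt

T-not⁻ : ∀ {b} → T (not b) → ¬ T b
T-not⁻ {false} _ ()

any-allFin⁺ : ∀ {n} (p : Fin n → Bool) x → T (p x) → T (any p (allFin n))
any-allFin⁺ p x px = any⁺ p (lose (∈-allFin x) px)

any-allFin⁻ : ∀ {n} (p : Fin n → Bool) → T (any p (allFin n)) → ∃[ x ] T (p x)
any-allFin⁻ p t = let x , _ , px = find (any⁻ p (allFin _) t) in x , px

∈⇒T : ∀ {n} {x : Fin n} {S} → x ∈ₛ S → T (lookup S x)
∈⇒T x∈S = from T-≡ ([]=⇒lookup x∈S)

T⇒∈ : ∀ {n} {x : Fin n} {S} → T (lookup S x) → x ∈ₛ S
T⇒∈ {x = x} {S} t = lookup⇒[]= x S (to T-≡ t)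

∈-tabulate⁺ : ∀ {n} {f : Fin n → Bool} {x} → T (f x) → x ∈ₛ tabulate f
∈-tabulate⁺ {f = f} {x} t = T⇒∈ (subst T (sym (lookup∘tabulate f x)) t)

∈-tabulate⁻ : ∀ {n} {f : Fin n → Bool} {x} → x ∈ₛ tabulate f → T (f x)
∈-tabulate⁻ {f = f} {x} x∈ = subst T (lookup∘tabulate f x) (∈⇒T x∈)

singleton-unique : ∀ {n} {A : Subset n} → ∣ A ∣ ≡ 1 → ∀ {x y} → x ∈ₛ A → y ∈ₛ A → x ≡ y
singleton-unique {A = A} ∣A∣≡1 {x} {y} x∈A y∈A with y ∈? ⁅ x ⁆
... | yes y∈x = sym (x∈⁅y⁆⇒x≡y x y∈x)
... | no  y∉x = ⊥-elim (<-irrefl (trans (∣⁅x⁆∣≡1 x) (sym ∣A∣≡1))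
  (p⊂q⇒∣p∣<∣q∣ ((λ z∈ → subst (_∈ₛ A) (sym (x∈⁅y⁆⇒x≡y x z∈)) x∈A) , y , y∈A , y∉x)))

singleton-nonempty : ∀ {n} {A : Subset n} → ∣ A ∣ ≡ 1 → Nonempty A
singleton-nonempty {n} {A} ∣A∣≡1 with nonempty? A
... | yes a = a
... | no ¬a with trans (sym (∣⊥∣≡0 n)) (trans (cong ∣_∣ (sym (Empty-unique ¬a))) ∣A∣≡1)
... | ()

module _ {n : ℕ} where

  ⋂ : List (Subset n) → Subset n
  ⋂ = List.foldr _∩ₛ_ ⊤

  ⊆-⋂ : ∀ {M} Cs → (∀ {C} → C ∈ Cs → M ⊆ C) → M ⊆ ⋂ Cs
  ⊆-⋂ []       M⊆ x∈M = ∈⊤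
  ⊆-⋂ (C ∷ Cs) M⊆ x∈M = x∈p∩q⁺ (M⊆ (here refl) x∈M , ⊆-⋂ Cs (M⊆ ∘ there) x∈M)

  ⋂-⊆ : ∀ Cs {C} → C ∈ Cs → ⋂ Cs ⊆ C
  ⋂-⊆ (C ∷ Cs) (here refl) x∈ = p∩q⊆p C (⋂ Cs) x∈
  ⋂-⊆ (C ∷ Cs) (there C∈)  x∈ = ⋂-⊆ Cs C∈ (p∩q⊆q C (⋂ Cs) x∈)

module _ {n : ℕ} {Σ : Base n} where

  closed-elim : ∀ {S} → Closed Σ S → ∀ {i} → i ∈ Σ → premise i ⊆ S → conclusion i ∈ₛ S
  closed-elim cl i∈Σ A⊆S with cl i∈Σ
  ... | inj₁ A⊈S = ⊥-elim (A⊈S A⊆S)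
  ... | inj₂ b∈S = b∈S

  closed-intro : ∀ {S} → (∀ {i} → i ∈ Σ → premise i ⊆ S → conclusion i ∈ₛ S) → Closed Σ S
  closed-intro {S} h {i} i∈Σ with premise i ⊆? S
  ... | yes A⊆S = inj₂ (h i∈Σ A⊆S)
  ... | no  A⊈S = inj₁ A⊈S

  closed-⊤ : Closed Σ ⊤
  closed-⊤ _ = inj₂ ∈⊤

  closed-∩ : ∀ {S S′} → Closed Σ S → Closed Σ S′ → Closed Σ (S ∩ₛ S′)
  closed-∩ {S} {S′} cl cl′ = closed-intro λ i∈Σ A⊆ → x∈p∩q⁺
    ( closed-elim cl  i∈Σ (λ x∈A → p∩q⊆p S S′ (A⊆ x∈A))
    , closed-elim cl′ i∈Σ (λ x∈A → p∩q⊆q S S′ (A⊆ x∈A)) )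

  closed-⋂ : ∀ Cs → (∀ {C} → C ∈ Cs → Closed Σ C) → Closed Σ (⋂ Cs)
  closed-⋂ []       cl = closed-⊤
  closed-⋂ (C ∷ Cs) cl = closed-∩ (cl (here refl)) (closed-⋂ Cs (cl ∘ there))

  meetIrreducible-⋂ : ∀ {M} → MeetIrreducible Σ M → ∀ Cs → (∀ {C} → C ∈ Cs → Closed Σ C) →
                      M ≡ ⋂ Cs → M ∈ Cs
  meetIrreducible-⋂ mi []       cl M≡ = ⊥-elim (MeetIrreducible.proper mi M≡)
  meetIrreducible-⋂ mi (C ∷ Cs) cl M≡
    with MeetIrreducible.irreducible mi (cl (here refl)) (closed-⋂ Cs (cl ∘ there)) M≡
  ... | inj₁ C≡M = here (sym C≡M)
  ... | inj₂ ⋂≡M = there (meetIrreducible-⋂ mi Cs (cl ∘ there) (sym ⋂≡M))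

-- The preorder generated by an implicational base

Rel : ℕ → Set
Rel n = Fin n → Fin n → Bool

module _ {n : ℕ} where

  record Preorder (R : Rel n) : Set where
    field
      reflexive  : ∀ i → T (R i i)
      transitive : ∀ i {j} k → T (R i j) → T (R j k) → T (R i k)

  UpClosed : Rel n → Subset n → Set
  UpClosed R S = ∀ i j → T (R i j) → i ∈ₛ S → j ∈ₛ S

  -- Expressed through `_<ᵇ_` so that a program can compute it with `ltF`.
  equality : Rel n
  equality i j = not ((toℕ i <ᵇ toℕ j) ∨ (toℕ j <ᵇ toℕ i))

  -- For a preorder `R` this is the preorder generated by `R` and the pairs of a member of `A` with
  -- `b`: one round suffices, without a closure to iterate.
  addImplication : Rel n → Implication n → Rel n
  addImplication R (A ⟶ b) i j = R i j ∨ (any (λ a → lookup A a ∧ R i a) (allFin n) ∧ R b j)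

  generated : Base n → Rel n
  generated = List.foldl addImplication equality

  equality⇒≡ : ∀ i j → T (equality i j) → i ≡ j
  equality⇒≡ i j t with <-cmp (toℕ i) (toℕ j)
  ... | tri< i<j _ _ = ⊥-elim (T-not⁻ t (from (T-∨ {toℕ i <ᵇ toℕ j}) (inj₁ (<⇒<ᵇ i<j))))
  ... | tri≈ _ i≡j _ = Fin.toℕ-injective i≡j
  ... | tri> _ _ i>j = ⊥-elim (T-not⁻ t (from (T-∨ {toℕ i <ᵇ toℕ j}) (inj₂ (<⇒<ᵇ i>j))))

  equality-preorder : Preorder equality
  equality-preorder = record
    { reflexive  = λ i → T-not⁺ λ t →
        [ irr i , irr i ]′ (to (T-∨ {toℕ i <ᵇ toℕ i}) t)
    ; transitive = λ i {j} k p q → subst (λ j → T (equality j k)) (sym (equality⇒≡ i j p)) q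
    }
    where
    irr : ∀ i → ¬ T (toℕ i <ᵇ toℕ i)
    irr i t = <-irrefl refl (<ᵇ⇒< (toℕ i) (toℕ i) t)

  module _ (R : Rel n) (A : Subset n) (b : Fin n) where

    private
      R′ : Rel n
      R′ = addImplication R (A ⟶ b)

    add-old : ∀ i j → T (R i j) → T (R′ i j)
    add-old i j p = from T-∨ (inj₁ p)

    add-new : ∀ i j {a} → a ∈ₛ A → T (R i a) → T (R b j) → T (R′ i j)
    add-new i j {a} a∈A p q = from (T-∨ {R i j}) (inj₂ (from T-∧
      (any-allFin⁺ (λ a → lookup A a ∧ R i a) a (from T-∧ (∈⇒T a∈A , p)) , q)))

    add-view : ∀ i j → T (R′ i j) →
               T (R i j) ⊎ (∃[ a ] a ∈ₛ A × T (R i a) × T (R b j))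
    add-view i j t with to (T-∨ {R i j}) t
    ... | inj₁ p = inj₁ p
    ... | inj₂ pq =
      let p , q = to T-∧ pq
          a , r = any-allFin⁻ (λ a → lookup A a ∧ R i a) p
          s , u = to T-∧ r
      in inj₂ (a , T⇒∈ s , u , q)

    add-preorder : Preorder R → Preorder R′
    add-preorder pre = record
      { reflexive  = λ i → add-old i i (reflexive i)
      ; transitive = λ i {j} k p q → case i j k (add-view i j p) (add-view j k q)
      }
      where
      open Preorder pre
      case : ∀ i j k → T (R i j) ⊎ (∃[ a ] a ∈ₛ A × T (R i a) × T (R b j)) →
             T (R j k) ⊎ (∃[ a ] a ∈ₛ A × T (R j a) × T (R b k)) → T (R′ i k)
      case i j k (inj₁ p) (inj₁ q)                   = add-old i k (transitive i k p q)
      case i j k (inj₁ p) (inj₂ (a , a∈A , q , r))   = add-new i k a∈A (transitive i a p q) r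
      case i j k (inj₂ (a , a∈A , p , q)) (inj₁ r)   = add-new i k a∈A p (transitive b k q r)
      -- A path that uses new pairs twice can enter at the first use and leave at the second,
      -- skipping everything between.
      case i j k (inj₂ (a , a∈A , p , _)) (inj₂ (_ , _ , _ , r)) = add-new i k a∈A p r

    -- The new relation lets any single member of `A` lead to `b`, whereas the implication asks for
    -- all of `A`; the two agree because `A` is a singleton.
    add-upClosed : ∣ A ∣ ≡ 1 → ∀ {S} → UpClosed R S → (A ⊆ S → b ∈ₛ S) → UpClosed R′ S
    add-upClosed ∣A∣≡1 {S} up b∈ i j t i∈S with add-view i j t
    ... | inj₁ p = up i j p i∈S
    ... | inj₂ (a , a∈A , p , q) = up b j q
      (b∈ λ x∈A → subst (_∈ₛ S) (singleton-unique ∣A∣≡1 a∈A x∈A) (up i a p i∈S))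

  addAll : Rel n → Base n → Rel n
  addAll = List.foldl addImplication

  addAll-preorder : ∀ R Σ → Preorder R → Preorder (addAll R Σ)
  addAll-preorder R []            pre = pre
  addAll-preorder R ((A ⟶ b) ∷ Σ) pre = addAll-preorder _ Σ (add-preorder R A b pre)

  addAll-old : ∀ R Σ i j → T (R i j) → T (addAll R Σ i j)
  addAll-old R []            i j p = p
  addAll-old R ((A ⟶ b) ∷ Σ) i j p = addAll-old _ Σ i j (add-old R A b i j p)

  addAll-new : ∀ R Σ → Preorder R → ∀ {A b a} → (A ⟶ b) ∈ Σ → a ∈ₛ A → T (addAll R Σ a b)
  addAll-new R (_ ∷ Σ) pre {A} {b} {a} (here refl) a∈A = addAll-old _ Σ a b
    (add-new R A b a b a∈A (Preorder.reflexive pre a) (Preorder.reflexive pre b))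
  addAll-new R ((A ⟶ b) ∷ Σ) pre (there i∈Σ) a∈A =
    addAll-new _ Σ (add-preorder R A b pre) i∈Σ a∈A

  addAll-upClosed : ∀ R Σ → UnitPremises Σ → ∀ {S} → UpClosed R S → Closed Σ S →
                    UpClosed (addAll R Σ) S
  addAll-upClosed R []            unit up cl = up
  addAll-upClosed R ((A ⟶ b) ∷ Σ) unit up cl = addAll-upClosed _ Σ (unit ∘ there)
    (add-upClosed R A b (unit (here refl)) up (closed-elim cl (here refl)))
    (cl ∘ there)

  generated-preorder : ∀ Σ → Preorder (generated Σ)
  generated-preorder Σ = addAll-preorder equality Σ equality-preorder

  closed⇔upClosed : ∀ Σ → UnitPremises Σ → ∀ S → Closed Σ S ⇔ UpClosed (generated Σ) S
  closed⇔upClosed Σ unit S = mk⇔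
    (addAll-upClosed equality Σ unit
      (λ i j p → subst (_∈ₛ S) (equality⇒≡ i j p)))
    (λ up → closed-intro λ {(A ⟶ b)} i∈Σ A⊆S →
      let a , a∈A = singleton-nonempty (unit i∈Σ)
      in up a b (addAll-new equality Σ equality-preorder i∈Σ a∈A) (A⊆S a∈A))

-- The reduction

module _ {n : ℕ} (R : Rel n) where

  -- All members of a class of mutually related elements but the least one.
  redundant : Fin n → Bool
  redundant j = any (λ i → (toℕ i <ᵇ toℕ j) ∧ (R i j ∧ R j i)) (allFin n)

  -- An arc forces j outright when j is redundant because of i.  Otherwise
  -- its premise is the whole class of i: as redundant elements are forced,
  -- it acts like the least member of the class.
  arcCondition : Rel n
  arcCondition i j = R i j ∧ (not (R j i) ∨ (toℕ i <ᵇ toℕ j))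

  -- The factor `not (R j i)` does not depend on `k`: it switches between the whole class of `i` and
  -- the empty premise.
  arcPremise : Fin n → Fin n → Subset n
  arcPremise i j = tabulate λ k → (R i k ∧ R k i) ∧ not (R j i)

  arc : Fin n → Fin n → Implication (suc n)
  arc i j = (outside ∷ arcPremise i j) ⟶ suc j

  arcIf : Fin n → Fin n → Base (suc n)
  arcIf i j = ifᵇ arcCondition i j then [ arc i j ] else []

  arcsFrom : Fin n → Base (suc n)
  arcsFrom i = concatMap (arcIf i) (allFin n)

  arcs : Base (suc n)
  arcs = concatMap arcsFrom (allFin n)

  toGoal : Subset n → Implication (suc n)
  toGoal B = (outside ∷ B) ⟶ zero

  cmiBase : Family n → Base (suc n)
  cmiBase 𝓑⁻ = arcs ++ List.map toGoal 𝓑⁻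

  saturate : Subset n → Subset n
  saturate S = tabulate λ y → lookup S y ∨ redundant y

  -- For a preorder `R`, the largest up-closed set without `x`. Equivalent elements give the same
  -- set, which is harmless since a list stands for the set of its members.
  notAbove : Fin n → Subset n
  notAbove x = tabulate λ y → not (R y x)

  upperSet : Fin n → Subset (suc n)
  upperSet x = inside ∷ saturate (notAbove x)

  lowerSet : Subset n → Subset (suc n)
  lowerSet B = outside ∷ saturate B

  uppers : Family (suc n)
  uppers = List.map upperSet (allFin n)

  cmiFamily : Family n → Family (suc n)
  cmiFamily 𝓑⁺ = uppers ++ List.map lowerSet 𝓑⁺

∈-if⁻ : ∀ {A : Set} {b} {x y : A} → y ∈ (ifᵇ b then [ x ] else []) → T b × y ≡ x
∈-if⁻ {b = true} (here eq) = tt , eq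

∈-if⁺ : ∀ {A : Set} {b} {x : A} → T b → x ∈ (ifᵇ b then [ x ] else [])
∈-if⁺ {b = true} _ = here refl

-- Closed sets and acyclicity of the constructed base

module Correctness {n : ℕ} (R : Rel n) (pre : Preorder R) (𝓑⁻ : Family n)
                   (up⁻ : ∀ {B} → B ∈ 𝓑⁻ → UpClosed R B) where

  open Preorder pre

  Σ′ : Base (suc n)
  Σ′ = cmiBase R 𝓑⁻

  φ : Subset n → Subset n
  φ = saturate R

  _~_ : Fin n → Fin n → Set
  i ~ j = T (R i j) × T (R j i)

  Redundant : Fin n → Set
  Redundant j = T (redundant R j)

  redundant⁺ : ∀ {i j} → toℕ i < toℕ j → i ~ j → Redundant j
  redundant⁺ {i} {j} i<j (p , q) =
    any-allFin⁺ (λ i → (toℕ i <ᵇ toℕ j) ∧ (R i j ∧ R j i)) i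
      (from T-∧ (<⇒<ᵇ i<j , from T-∧ (p , q)))

  redundant⁻ : ∀ {j} → Redundant j → ∃[ i ] toℕ i < toℕ j × i ~ j
  redundant⁻ {j} t =
    let i , u = any-allFin⁻ (λ i → (toℕ i <ᵇ toℕ j) ∧ (R i j ∧ R j i)) t
        v , w = to (T-∧ {toℕ i <ᵇ toℕ j}) u
    in i , <ᵇ⇒< (toℕ i) (toℕ j) v , to T-∧ w

  representative : ∀ x → ∃[ r ] r ~ x × ¬ Redundant r
  representative x = go x (<-wellFounded (toℕ x))
    where
    go : ∀ x → Acc _<_ (toℕ x) → ∃[ r ] r ~ x × ¬ Redundant r
    go x (acc rec) with T? (redundant R x)
    ... | no ¬red = x , (reflexive x , reflexive x) , ¬red
    ... | yes red =
      let i , i<x , p , q = redundant⁻ red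
          r , (u , v) , ¬red = go i (rec i<x)
      in r , (transitive r x u p , transitive x r q v) , ¬red

  ∈φ⁺ : ∀ {S y} → y ∈ₛ S → y ∈ₛ φ S
  ∈φ⁺ y∈S = ∈-tabulate⁺ (from T-∨ (inj₁ (∈⇒T y∈S)))

  redundant∈φ : ∀ S {y} → Redundant y → y ∈ₛ φ S
  redundant∈φ S {y} red = ∈-tabulate⁺ (from (T-∨ {lookup S y}) (inj₂ red))

  ∈φ⁻ : ∀ S {y} → y ∈ₛ φ S → y ∈ₛ S ⊎ Redundant y
  ∈φ⁻ S {y} y∈ with to (T-∨ {lookup S y}) (∈-tabulate⁻ y∈)
  ... | inj₁ t   = inj₁ (T⇒∈ t)
  ... | inj₂ red = inj₂ red

  φ-mono : ∀ {S S′} → S ⊆ S′ → φ S ⊆ φ S′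
  φ-mono {S} {S′} S⊆ y∈ with ∈φ⁻ S y∈
  ... | inj₁ y∈S = ∈φ⁺ (S⊆ y∈S)
  ... | inj₂ red = redundant∈φ S′ red

  -- Saturation blurs only redundant elements. Each class has a member that is not redundant, and an
  -- up-closed set contains all of a class or nothing of it, so this member decides.
  ⊆φ⇒⊆ : ∀ {S S′} → UpClosed R S → UpClosed R S′ → S ⊆ φ S′ → S ⊆ S′
  ⊆φ⇒⊆ {S′ = S′} up up′ S⊆ {x} x∈S with representative x
  ... | r , (p , q) , ¬red with ∈φ⁻ S′ (S⊆ (up x r q x∈S))
  ... | inj₁ r∈S′ = up′ r x p r∈S′
  ... | inj₂ red  = ⊥-elim (¬red red)

  φ-injective : ∀ {S S′} → UpClosed R S → UpClosed R S′ → φ S ≡ φ S′ → S ≡ S′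
  φ-injective up up′ eq = ⊆-antisym
    (⊆φ⇒⊆ up up′ (λ x∈ → subst (_ ∈ₛ_) eq (∈φ⁺ x∈)))
    (⊆φ⇒⊆ up′ up (λ x∈ → subst (_ ∈ₛ_) (sym eq) (∈φ⁺ x∈)))

  data ImplicationView : Implication (suc n) → Set where
    isArc  : ∀ i j → T (arcCondition R i j) → ImplicationView (arc R i j)
    isGoal : ∀ {B} → B ∈ 𝓑⁻ → ImplicationView (toGoal R B)

  implicationView : ∀ {i} → i ∈ Σ′ → ImplicationView i
  implicationView i∈ with ∈-++⁻ (arcs R) i∈
  ... | inj₁ i∈arcs with find (∈-concatMap⁻ (arcsFrom R) {xs = allFin n} i∈arcs)
  ...   | x , _ , i∈from with find (∈-concatMap⁻ (arcIf R x) {xs = allFin n} i∈from)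
  ...     | y , _ , i∈if with ∈-if⁻ {b = arcCondition R x y} i∈if
  ...       | t , refl = isArc x y t
  implicationView i∈ | inj₂ i∈goals with ∈-map⁻ (toGoal R) i∈goals
  ...   | B , B∈ , refl = isGoal B∈

  arc∈ : ∀ i j → T (arcCondition R i j) → arc R i j ∈ Σ′
  arc∈ i j t = ∈-++⁺ˡ (∈-concatMap⁺ (arcsFrom R) {xs = allFin n} (lose (∈-allFin i)
    (∈-concatMap⁺ (arcIf R i) {xs = allFin n} (lose (∈-allFin j) (∈-if⁺ t)))))

  goal∈ : ∀ {B} → B ∈ 𝓑⁻ → toGoal R B ∈ Σ′
  goal∈ B∈ = ∈-++⁺ʳ (arcs R) (∈-map⁺ (toGoal R) B∈)

  -- The strict part of `R` with the new point `zero` on top. Every arc of the implication graph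
  -- goes up in this strict order, which rules out cycles.
  _≺_ : Fin (suc n) → Fin (suc n) → Set
  suc i ≺ suc j = T (R i j) × ¬ T (R j i)
  suc i ≺ zero  = Unit
  zero  ≺ _     = ⊥

  ≺-trans : ∀ x y z → x ≺ y → y ≺ z → x ≺ z
  ≺-trans (suc i) (suc j) (suc k) (p , ¬q) (r , ¬s) =
    transitive i k p r , λ t → ¬q (transitive j i r t)
  ≺-trans (suc i) (suc j) zero    p q = tt

  arcPremise⁻ : ∀ {i j k} → k ∈ₛ arcPremise R i j → i ~ k × ¬ T (R j i)
  arcPremise⁻ {i} {j} {k} k∈ =
    let p , q = to (T-∧ {R i k ∧ R k i}) (∈-tabulate⁻ k∈) in to T-∧ p , T-not⁻ q

  -- A member of the premise comes with `¬ T (R j i)`, so an arc between old points leaves its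
  -- class; an implication that forces its conclusion has no premise to start an arc from.
  Arc⇒≺ : ∀ {x y} → Arc Σ′ x y → x ≺ y
  Arc⇒≺ (A , A∈ , x∈A) with implicationView A∈
  Arc⇒≺ (A , A∈ , there x∈B) | isGoal B∈ = tt
  Arc⇒≺ (A , A∈ , there k∈)  | isArc i j t =
    let (p , q) , ¬r = arcPremise⁻ k∈
        s , _ = to T-∧ t
    in transitive _ j q s , λ u → ¬r (transitive j i u q)

  acyclic : Acyclic Σ′
  acyclic x path = irr x (go path)
    where
    go : ∀ {x y} → TransClosure (Arc Σ′) x y → x ≺ y
    go (single a)  = Arc⇒≺ a
    go (a ∷⁺ path) = ≺-trans _ _ _ (Arc⇒≺ a) (go path)
    irr : ∀ x → ¬ (x ≺ x)
    irr (suc i) (p , ¬p) = ¬p p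

  Avoiding : Subset n → Set
  Avoiding S = ∀ {B} → B ∈ 𝓑⁻ → B ⊈ S

  data ClosedView : Subset (suc n) → Set where
    upper : ∀ S → UpClosed R S → ClosedView (inside ∷ φ S)
    lower : ∀ S → UpClosed R S → Avoiding S → ClosedView (outside ∷ φ S)

  -- If the arc is strict, the representative of `i` belongs to the premise, and not being redundant
  -- it must come from `S` itself; from there up-closure leads to `j`. If it is not strict, `j` is
  -- redundant.
  arc-satisfied : ∀ {b S i j} → UpClosed R S → T (arcCondition R i j) →
                  arcPremise R i j ⊆ φ S → suc j ∈ₛ (b ∷ φ S)
  arc-satisfied {S = S} {i} {j} up t A⊆ with T? (R j i)
  ... | no ¬r with representative i
  ...   | r , (p , q) , ¬red
          with ∈φ⁻ S (A⊆ (∈-tabulate⁺ (from T-∧ (from T-∧ (q , p) , T-not⁺ ¬r))))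
  ...     | inj₁ r∈S = there (∈φ⁺ (up r j (transitive r j p (proj₁ (to T-∧ t))) r∈S))
  ...     | inj₂ red = ⊥-elim (¬red red)
  arc-satisfied {S = S} {i} {j} up t A⊆ | yes r with to (T-∧ {R i j}) t
  ... | p , q with to (T-∨ {not (R j i)}) q
  ... | inj₁ ¬r = ⊥-elim (T-not⁻ ¬r r)
  ... | inj₂ i<j = there (redundant∈φ S (redundant⁺ (<ᵇ⇒< (toℕ i) (toℕ j) i<j) (p , r)))

  closedView⇒closed : ∀ {M} → ClosedView M → Closed Σ′ M
  closedView⇒closed (upper S up) = closed-intro λ i∈ A⊆ → satisfied (implicationView i∈) A⊆
    where
    satisfied : ∀ {i} → ImplicationView i → premise i ⊆ inside ∷ φ S →
                conclusion i ∈ₛ (inside ∷ φ S)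
    satisfied (isArc i j t) A⊆ = arc-satisfied up t (drop-∷-⊆ A⊆)
    satisfied (isGoal B∈)   A⊆ = here
  closedView⇒closed (lower S up avoids) = closed-intro λ i∈ A⊆ → satisfied (implicationView i∈) A⊆
    where
    satisfied : ∀ {i} → ImplicationView i → premise i ⊆ outside ∷ φ S →
                conclusion i ∈ₛ (outside ∷ φ S)
    satisfied (isArc i j t) A⊆ = arc-satisfied up t (drop-∷-⊆ A⊆)
    satisfied (isGoal B∈)   A⊆ = ⊥-elim (avoids B∈ (⊆φ⇒⊆ (up⁻ B∈) up (drop-∷-⊆ A⊆)))

  class⊆ : Fin n → Subset n → Set
  class⊆ x S = ∀ k → x ~ k → k ∈ₛ S

  class⊆? : ∀ x S → Dec (class⊆ x S)
  class⊆? x S = Fin.all? λ k → (T? (R x k) ×-dec T? (R k x)) →-dec (k ∈? S)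

  -- Undoes `φ` on closed sets: keeping only classes contained in `S` as a whole discards the
  -- elements that are present merely because they are forced.
  ψ : Subset n → Subset n
  ψ S = tabulate λ x → ⌊ class⊆? x S ⌋

  ∈ψ⁺ : ∀ {x S} → class⊆ x S → x ∈ₛ ψ S
  ∈ψ⁺ {x} {S} h = ∈-tabulate⁺ (fromWitness {a? = class⊆? x S} h)

  ∈ψ⁻ : ∀ {x S} → x ∈ₛ ψ S → class⊆ x S
  ∈ψ⁻ {x} {S} x∈ = toWitness {a? = class⊆? x S} (∈-tabulate⁻ x∈)

  module _ {b S} (cl : Closed Σ′ (b ∷ S)) where

    ψ-upClosed : UpClosed R (ψ S)
    ψ-upClosed x y p x∈ψ with T? (R y x)
    ... | yes q = ∈ψ⁺ λ k (r , s) → ∈ψ⁻ x∈ψ k (transitive x k p r , transitive k x s q)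
    -- Each `k` in the class of `y` lies strictly above `x` and has its own arc from the class of
    -- `x`, so the whole class of `y` is obtained.
    ... | no ¬q = ∈ψ⁺ λ k (r , s) →
      let ¬kx = λ t → ¬q (transitive y x r t)
      in drop-there (closed-elim cl
           (arc∈ x k (from T-∧ (transitive x k p r , from T-∨ (inj₁ (T-not⁺ ¬kx)))))
           (out⊆ λ m∈ → ∈ψ⁻ x∈ψ _ (proj₁ (arcPremise⁻ m∈))))

    redundant∈ : ∀ {i j} → toℕ i < toℕ j → i ~ j → j ∈ₛ S
    redundant∈ {i} {j} i<j (p , q) = drop-there (closed-elim cl
      (arc∈ i j (from T-∧ (p , from (T-∨ {not (R j i)}) (inj₂ (<⇒<ᵇ i<j)))))
      (out⊆ λ m∈ → ⊥-elim (proj₂ (arcPremise⁻ m∈) q)))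

    -- An element of `S` that is not redundant is the least of its class, and the rest of the class
    -- is forced into `S`; hence the class lies in `S` as a whole.
    φψ : φ (ψ S) ≡ S
    φψ = ⊆-antisym φψ⊆ ⊆φψ
      where
      φψ⊆ : φ (ψ S) ⊆ S
      φψ⊆ {x} x∈ with ∈φ⁻ (ψ S) x∈
      ... | inj₁ x∈ψ = ∈ψ⁻ x∈ψ x (reflexive x , reflexive x)
      ... | inj₂ red = let i , i<x , e = redundant⁻ red in redundant∈ i<x e
      ⊆φψ : S ⊆ φ (ψ S)
      ⊆φψ {x} x∈S with T? (redundant R x)
      ... | yes red = redundant∈φ (ψ S) red
      ... | no ¬red = ∈φ⁺ (∈ψ⁺ class)
        where
        class : class⊆ x S
        class k (p , q) with <-cmp (toℕ x) (toℕ k)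
        ... | tri< x<k _ _ = redundant∈ x<k (p , q)
        ... | tri≈ _ x≡k _ = subst (_∈ₛ S) (Fin.toℕ-injective x≡k) x∈S
        ... | tri> _ _ k<x = ⊥-elim (¬red (redundant⁺ k<x (q , p)))

    ψ-avoiding : b ≡ outside → Avoiding (ψ S)
    ψ-avoiding refl B∈ B⊆
      with closed-elim cl (goal∈ B∈) (out⊆ λ x∈ → subst (_ ∈ₛ_) φψ (∈φ⁺ (B⊆ x∈)))
    ... | ()

  closedView : ∀ {M} → Closed Σ′ M → ClosedView M
  closedView {inside  ∷ S} cl = subst (λ S → ClosedView (inside ∷ S)) (φψ cl)
    (upper (ψ S) (ψ-upClosed cl))
  closedView {outside ∷ S} cl = subst (λ S → ClosedView (outside ∷ S)) (φψ cl)
    (lower (ψ S) (ψ-upClosed cl) (ψ-avoiding cl refl))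

  -- Meet-irreducible sets and maximal avoiding sets

  record Maximal (S : Subset n) : Set where
    field
      upClosed : UpClosed R S
      avoiding : Avoiding S
      maximal  : ∀ {S′} → UpClosed R S′ → Avoiding S′ → S ⊆ S′ → S′ ⊆ S

  notAbove-upClosed : ∀ x → UpClosed R (notAbove R x)
  notAbove-upClosed x i j p i∈ = ∈-tabulate⁺ (T-not⁺ λ q →
    T-not⁻ (∈-tabulate⁻ i∈) (transitive i x p q))

  ∉notAbove : ∀ {x} → x ∉ₛ notAbove R x
  ∉notAbove {x} x∈ = T-not⁻ (∈-tabulate⁻ x∈) (reflexive x)

  ⊆notAbove : ∀ {S x} → UpClosed R S → x ∉ₛ S → S ⊆ notAbove R x
  ⊆notAbove {x = x} up x∉ {y} y∈ = ∈-tabulate⁺ (T-not⁺ λ p → x∉ (up y x p y∈))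

  -- A factor whose up-closed set misses `x` is contained in the given set, hence equal to it. If
  -- both contain `x`, they contain its representative, which the given set lacks; `x` itself would
  -- not do, as it may be redundant and so belong to every closed set.
  notAbove-meetIrreducible : ∀ x → MeetIrreducible Σ′ (inside ∷ φ (notAbove R x))
  notAbove-meetIrreducible x = record
    { closed      = closedView⇒closed (upper _ (notAbove-upClosed x))
    ; proper      = proper
    ; irreducible = λ cl₁ cl₂ → irreducible (closedView cl₁) (closedView cl₂)
    }
    where
    U : Subset n
    U = notAbove R x
    proper : inside ∷ φ U ≢ ⊤
    proper eq with representative x
    ... | r , (p , q) , ¬red with ∈φ⁻ U (drop-there (subst (suc r ∈ₛ_) (sym eq) ∈⊤))
    ...   | inj₁ r∈ = T-not⁻ (∈-tabulate⁻ r∈) p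
    ...   | inj₂ red = ¬red red
    irreducible : ∀ {C₁ C₂} → ClosedView C₁ → ClosedView C₂ → inside ∷ φ U ≡ C₁ ∩ₛ C₂ →
                  C₁ ≡ inside ∷ φ U ⊎ C₂ ≡ inside ∷ φ U
    irreducible (upper S₁ up₁) (upper S₂ up₂) eq with x ∈? S₁ | x ∈? S₂
    ... | no x∉S₁ | _ = inj₁ (cong (inside ∷_) (⊆-antisym (φ-mono (⊆notAbove up₁ x∉S₁))
      (λ y∈ → p∩q⊆p (φ S₁) (φ S₂) (subst (_ ∈ₛ_) (cong Vec.tail eq) y∈))))
    ... | yes _ | no x∉S₂ = inj₂ (cong (inside ∷_) (⊆-antisym (φ-mono (⊆notAbove up₂ x∉S₂))
      (λ y∈ → p∩q⊆q (φ S₁) (φ S₂) (subst (_ ∈ₛ_) (cong Vec.tail eq) y∈))))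
    ... | yes x∈S₁ | yes x∈S₂ with representative x
    ...   | r , (p , q) , ¬red
            with ∈φ⁻ U (subst (_ ∈ₛ_) (sym (cong Vec.tail eq))
                   (x∈p∩q⁺ {p = φ S₁} {q = φ S₂} (∈φ⁺ (up₁ x r q x∈S₁) , ∈φ⁺ (up₂ x r q x∈S₂))))
    ...     | inj₁ r∈ = ⊥-elim (T-not⁻ (∈-tabulate⁻ r∈) p)
    ...     | inj₂ red = ⊥-elim (¬red red)
    irreducible (upper _ _)   (lower _ _ _) ()
    irreducible {C₂ = _ ∷ _} (lower _ _ _) _ ()

  -- The set is the intersection of the sets `C x` with `x` outside `S`, since an element outside
  -- `S` is missing from its own `C x` unless it is redundant. Being meet-irreducible, it is one of
  -- them.
  upper-meetIrreducible : ∀ {S} → UpClosed R S → MeetIrreducible Σ′ (inside ∷ φ S) →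
                          inside ∷ φ S ∈ uppers R
  upper-meetIrreducible {S} up mi =
    let x , _ , eq , _ = ∈-map∘filter⁻ C outside? {xs = allFin n}
                           (meetIrreducible-⋂ mi Cs Cs-closed (⊆-antisym ⊆Cs Cs⊆))
    in subst (_∈ List.map C (allFin n)) (sym eq) (∈-map⁺ C (∈-allFin x))
    where
    outside? : ∀ x → Dec (x ∉ₛ S)
    outside? x = ¬? (x ∈? S)
    C : Fin n → Subset (suc n)
    C x = inside ∷ φ (notAbove R x)
    Cs : List (Subset (suc n))
    Cs = List.map C (filter outside? (allFin n))
    Cs-closed : ∀ {D} → D ∈ Cs → Closed Σ′ D
    Cs-closed D∈ with ∈-map∘filter⁻ C outside? {xs = allFin n} D∈
    ... | x , _ , refl , _ = closedView⇒closed (upper _ (notAbove-upClosed x))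
    ⊆Cs : inside ∷ φ S ⊆ ⋂ Cs
    ⊆Cs = ⊆-⋂ Cs below
      where
      below : ∀ {D} → D ∈ Cs → inside ∷ φ S ⊆ D
      below D∈ with ∈-map∘filter⁻ C outside? {xs = allFin n} D∈
      ... | x , _ , refl , x∉S = in⊆in (φ-mono (⊆notAbove up x∉S))
    Cs⊆ : ⋂ Cs ⊆ inside ∷ φ S
    Cs⊆ {zero}  _  = here
    Cs⊆ {suc y} y∈ with y ∈? S
    ... | yes y∈S = there (∈φ⁺ y∈S)
    ... | no  y∉S
          with ∈φ⁻ (notAbove R y) (drop-there (⋂-⊆ Cs
                 (∈-map∘filter⁺ C outside? {xs = allFin n} (y , ∈-allFin y , refl , y∉S)) y∈))
    ...   | inj₁ y∈ = ⊥-elim (∉notAbove y∈)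
    ...   | inj₂ red = there (redundant∈φ S red)

  -- For an avoiding `S′` above `S`, the set is the meet of its own copy with z, `inside ∷ φ S`, and
  -- `outside ∷ φ S′`. The first differs from it at z, so the second equals it.
  lower-meetIrreducible⇒maximal : ∀ {S} → UpClosed R S → Avoiding S →
                                  MeetIrreducible Σ′ (outside ∷ φ S) → Maximal S
  lower-meetIrreducible⇒maximal {S} up avoids mi = record
    { upClosed = up ; avoiding = avoids ; maximal = maximal }
    where
    maximal : ∀ {S′} → UpClosed R S′ → Avoiding S′ → S ⊆ S′ → S′ ⊆ S
    maximal {S′} up′ avoids′ S⊆S′
      with MeetIrreducible.irreducible mi
             (closedView⇒closed (upper S up)) (closedView⇒closed (lower S′ up′ avoids′))
             (cong (outside ∷_)
               (⊆-antisym (λ x∈ → x∈p∩q⁺ (x∈ , φ-mono S⊆S′ x∈)) (p∩q⊆p (φ S) (φ S′))))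
    ... | inj₁ ()
    ... | inj₂ eq = ⊆-reflexive (φ-injective up′ up (cong Vec.tail eq))

  -- One of two factors must miss z. Its up-closed set then avoids `𝓑⁻` and contains `S`, so
  -- maximality identifies the two.
  maximal⇒meetIrreducible : ∀ {S} → Maximal S → MeetIrreducible Σ′ (outside ∷ φ S)
  maximal⇒meetIrreducible {S} max = record
    { closed      = closedView⇒closed (lower S upClosed avoiding)
    ; proper      = λ ()
    ; irreducible = λ cl₁ cl₂ → irreducible (closedView cl₁) (closedView cl₂)
    }
    where
    open Maximal max
    collapse : ∀ {S′} → UpClosed R S′ → Avoiding S′ → φ S ⊆ φ S′ →
               outside ∷ φ S′ ≡ outside ∷ φ S
    collapse up′ avoids′ φ⊆ = cong (outside ∷_) (⊆-antisym
      (φ-mono (maximal up′ avoids′ (⊆φ⇒⊆ upClosed up′ (λ x∈ → φ⊆ (∈φ⁺ x∈)))))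
      φ⊆)
    irreducible : ∀ {C₁ C₂} → ClosedView C₁ → ClosedView C₂ → outside ∷ φ S ≡ C₁ ∩ₛ C₂ →
                  C₁ ≡ outside ∷ φ S ⊎ C₂ ≡ outside ∷ φ S
    irreducible (upper _ _) (upper _ _) ()
    irreducible {C₂ = _ ∷ T₂} (lower S₁ up₁ avoids₁) _ eq = inj₁ (collapse up₁ avoids₁
      (λ y∈ → p∩q⊆p (φ S₁) T₂ (subst (_ ∈ₛ_) (cong Vec.tail eq) y∈)))
    irreducible (upper S₁ _) (lower S₂ up₂ avoids₂) eq = inj₂ (collapse up₂ avoids₂
      (λ y∈ → p∩q⊆q (φ S₁) (φ S₂) (subst (_ ∈ₛ_) (cong Vec.tail eq) y∈)))

  hit? : ∀ S → Dec (Any (_⊆ S) 𝓑⁻)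
  hit? S = any? (_⊆? S) 𝓑⁻

  ¬hit⇒avoiding : ∀ {S} → ¬ Any (_⊆ S) 𝓑⁻ → Avoiding S
  ¬hit⇒avoiding ¬hit B∈ B⊆ = ¬hit (lose B∈ B⊆)

  above : Fin n → Subset n
  above x = tabulate (R x)

  -- It suffices to try adding one principal up-set at a time: if a larger avoiding set contains `y`
  -- outside `S`, then it contains `S ∪ₛ above y`, which therefore avoids `𝓑⁻` as well.
  extend : ∀ S → UpClosed R S → Avoiding S → ∃[ S′ ] Maximal S′ × S ⊆ S′
  extend S = go S (⊃-wellFounded S)
    where
    go : ∀ S → Acc _⊃_ S → UpClosed R S → Avoiding S → ∃[ S′ ] Maximal S′ × S ⊆ S′
    go S (acc rec) up avoids with Fin.any? (λ x → ¬? (x ∈? S) ×-dec ¬? (hit? (S ∪ₛ above x)))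
    ... | yes (x , x∉S , ¬hit) =
      let S′ , max , ⊆S′ = go (S ∪ₛ above x)
            (rec (p⊆p∪q (above x) , x , q⊆p∪q S (above x) (∈-tabulate⁺ (reflexive x)) , x∉S))
            up′ (¬hit⇒avoiding ¬hit)
      in S′ , max , λ y∈ → ⊆S′ (p⊆p∪q (above x) y∈)
      where
      up′ : UpClosed R (S ∪ₛ above x)
      up′ i j p i∈ with x∈p∪q⁻ S (above x) i∈
      ... | inj₁ i∈S = p⊆p∪q (above x) (up i j p i∈S)
      ... | inj₂ i∈x = q⊆p∪q S (above x) (∈-tabulate⁺ (transitive x j (∈-tabulate⁻ i∈x) p))
    ... | no ¬ext =
      S , record { upClosed = up ; avoiding = avoids ; maximal = maximal } , λ y∈ → y∈
      where
      maximal : ∀ {S′} → UpClosed R S′ → Avoiding S′ → S ⊆ S′ → S′ ⊆ S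
      maximal {S′} up′ avoids′ S⊆S′ {y} y∈ with y ∈? S
      ... | yes y∈S = y∈S
      ... | no  y∉S = ⊥-elim (¬ext (y , y∉S , λ hit →
        let B , B∈ , B⊆ = find hit
        in avoids′ B∈ λ b∈ →
             [ S⊆S′ , (λ b∈y → up′ y _ (∈-tabulate⁻ b∈y) y∈) ]′ (x∈p∪q⁻ S (above y) (B⊆ b∈))))

  module _ (𝓑⁺ : Family n) (up⁺ : ∀ {B} → B ∈ 𝓑⁺ → UpClosed R B) where

    -- The sets with z are accounted for by `uppers` in every case, so the two families can differ
    -- only in sets without z. There `φ` is injective on up-closed sets and carries the comparison
    -- back to `𝓑⁺`.
    CMI⇔maximal : (∀ M → M ∈ cmiFamily R 𝓑⁺ ⇔ MeetIrreducible Σ′ M) ⇔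
                  (∀ S → S ∈ 𝓑⁺ ⇔ Maximal S)
    CMI⇔maximal = mk⇔ forth back
      where
      forth : (∀ M → M ∈ cmiFamily R 𝓑⁺ ⇔ MeetIrreducible Σ′ M) → ∀ S → S ∈ 𝓑⁺ ⇔ Maximal S
      forth cmi S = mk⇔ sound complete
        where
        avoids : MeetIrreducible Σ′ (lowerSet R S) → Avoiding S
        avoids mi B∈ B⊆
          with closed-elim (MeetIrreducible.closed mi) (goal∈ B∈) (out⊆ λ x∈ → ∈φ⁺ (B⊆ x∈))
        ... | ()
        sound : S ∈ 𝓑⁺ → Maximal S
        sound S∈ = lower-meetIrreducible⇒maximal (up⁺ S∈) (avoids mi) mi
          where
          mi : MeetIrreducible Σ′ (lowerSet R S)
          mi = to (cmi (lowerSet R S)) (∈-++⁺ʳ (uppers R) (∈-map⁺ (lowerSet R) S∈))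
        complete : Maximal S → S ∈ 𝓑⁺
        complete max
          with ∈-++⁻ (uppers R) (from (cmi (lowerSet R S)) (maximal⇒meetIrreducible max))
        ... | inj₁ S∈ with ∈-map⁻ (upperSet R) S∈
        ...   | _ , _ , ()
        complete max | inj₂ S∈ with ∈-map⁻ (lowerSet R) S∈
        ...   | B , B∈ , eq = subst (_∈ 𝓑⁺)
          (sym (φ-injective (Maximal.upClosed max) (up⁺ B∈) (cong Vec.tail eq))) B∈
      back : (∀ S → S ∈ 𝓑⁺ ⇔ Maximal S) → ∀ M → M ∈ cmiFamily R 𝓑⁺ ⇔ MeetIrreducible Σ′ M
      back h M = mk⇔ sound complete
        where
        sound : M ∈ cmiFamily R 𝓑⁺ → MeetIrreducible Σ′ M
        sound M∈ with ∈-++⁻ (uppers R) M∈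
        ... | inj₁ M∈uppers with ∈-map⁻ (upperSet R) M∈uppers
        ...   | x , _ , refl = notAbove-meetIrreducible x
        sound M∈ | inj₂ M∈lowers with ∈-map⁻ (lowerSet R) M∈lowers
        ...   | B , B∈ , refl = maximal⇒meetIrreducible (to (h B) B∈)
        member : ∀ {M} → ClosedView M → MeetIrreducible Σ′ M → M ∈ cmiFamily R 𝓑⁺
        member (upper S up)        mi = ∈-++⁺ˡ (upper-meetIrreducible up mi)
        member (lower S up avoids) mi = ∈-++⁺ʳ (uppers R)
          (∈-map⁺ (lowerSet R) (from (h S) (lower-meetIrreducible⇒maximal up avoids mi)))
        complete : MeetIrreducible Σ′ M → M ∈ cmiFamily R 𝓑⁺
        complete mi = member (closedView (MeetIrreducible.closed mi)) mi

-- The reduction as a program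

encodeRel : ∀ {n} → Rel n → Tree
encodeRel R = encodeList encodeSubset (toList (tabulate λ i → tabulate (R i)))

nthF-tabulate : ∀ {n} (f : Fin n → Bool) i {L J d} →
                L at d yields encodeSubset (tabulate f) → J at d yields encodeFin i →
                nthF L J at d yields encodeBool (f i)
nthF-tabulate f i {L} {J} {d} eqL eqJ = subst (λ b → nthF L J at d yields encodeBool b)
  (lookup∘tabulate f i) (nthF-spec encodeBool (tabulate f) i eqL eqJ)

opaque

  bitF : PolyFun → PolyFun → PolyFun → PolyFun
  bitF R I J = nthF (nthF R I) J

  bitF-spec : ∀ {n} (r : Rel n) i j {R I J d} →
              R at d yields encodeRel r → I at d yields encodeFin i → J at d yields encodeFin j →
              bitF R I J at d yields encodeBool (r i j)
  bitF-spec r i j {R} {I} {J} {d} eqR eqI eqJ = nthF-tabulate (r i) j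
    (subst (λ S → nthF R I at d yields encodeSubset S) (lookup∘tabulate (λ i → tabulate (r i)) i)
      (nthF-spec encodeSubset (tabulate λ i → tabulate (r i)) i eqR eqI))
    eqJ

equalityF : PolyFun
equalityF = tabulateF (tabulateF (notF (orF (ltF (ref 1) (ref 0)) (ltF (ref 0) (ref 1)))) (ref 1)) (ref 0)

equalityF-spec : ∀ n d → equalityF at cons (encodeℕ n) d yields encodeRel (equality {n})
equalityF-spec n d = tabulateF-spec encodeSubset (yields refl) λ i →
  tabulateF-spec encodeBool (yields refl) λ j →
    notF-spec (orF-spec (ltF-spec (toℕ i) (toℕ j) (yields refl) (yields refl))
                        (ltF-spec (toℕ j) (toℕ i) (yields refl) (yields refl)))

-- The implication being added is the head of the remaining list, which
-- is the element number 2 (number 3 under anyF) of the environment.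
conclusionF premiseF addedBitF addImplicationF : PolyFun
conclusionF     = exprF (tl (hd (hd (drop 2))))
premiseF        = exprF (hd (hd (hd (drop 3))))
addedBitF       = orF (bitF (ref 3) (ref 1) (ref 0))
                      (andF (anyF (andF (nthF premiseF (ref 0)) (bitF (ref 4) (ref 2) (ref 0)))
                                  (rangeF (ref 4)))
                            (bitF (ref 3) conclusionF (ref 0)))
addImplicationF = tabulateF (tabulateF addedBitF (ref 3)) (ref 2)

addImplicationF-spec : ∀ {n} (A : Subset n) b (R : Rel n) t d →
  addImplicationF at cons (cons (encodeImplication (A ⟶ b)) t) (cons (encodeRel R) (cons (encodeℕ n) d))
  yields encodeRel (addImplication R (A ⟶ b))
addImplicationF-spec A b R t d = tabulateF-spec encodeSubset (yields refl) λ i →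
  tabulateF-spec encodeBool (yields refl) λ j →
    orF-spec
      (bitF-spec R i j (yields refl) (yields refl) (yields refl))
      (andF-spec
        (anyF-spec encodeFin (rangeF-spec (yields refl)) λ a →
          andF-spec (nthF-spec encodeBool A a (yields refl) (yields refl))
                    (bitF-spec R i a (yields refl) (yields refl) (yields refl)))
        (bitF-spec R b j (yields refl) (yields refl) (yields refl)))

tableSpace : Polynomial
tableSpace = tabulateSpace (tabulateSpace (con 3))

-- The new table is bounded outright by the numeral at the head of `d` and the bit size 3; the old
-- table enters the bound only as slack.
addImplicationF-growth : Growth addImplicationF tableSpace
addImplicationF-growth l a d = ≤-trans
  (size-tabulateF (tabulateF addedBitF (ref 3)) (ref 2) (tabulateSpace (con 3)) n≤ λ i →
    size-tabulateF addedBitF (ref 3) (con 3) n≤ λ j → size-orF _ _ _)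
  (m≤n+m _ (size a))
  where
  n≤ : size (head d) ≤ size l + size d
  n≤ = ≤-trans (size-head d) (m≤n+m (size d) (size l))

generatedF : PolyFun
generatedF = foldF addImplicationF tableSpace addImplicationF-growth equalityF (ref 1)

generatedF-spec : ∀ {n} (Σ : Base n) d →
  generatedF at cons (encodeℕ n) (cons (encodeBase Σ) d) yields encodeRel (generated Σ)
generatedF-spec Σ d = foldF-spec encodeImplication encodeRel addImplication
  (equalityF-spec _ _) (yields refl) λ { (A ⟶ b) t R → addImplicationF-spec A b R t _ }

redundantF : PolyFun
redundantF = tabulateF
  (anyF (andF (ltF (ref 0) (ref 1)) (andF (bitF (ref 2) (ref 0) (ref 1)) (bitF (ref 2) (ref 1) (ref 0))))
        (rangeF (ref 2)))
  (ref 1)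

redundantF-spec : ∀ {n} (R : Rel n) d →
  redundantF at cons (encodeRel R) (cons (encodeℕ n) d) yields encodeSubset (tabulate (redundant R))
redundantF-spec R d = tabulateF-spec encodeBool (yields refl) λ j →
  anyF-spec encodeFin (rangeF-spec (yields refl)) λ i →
    andF-spec (ltF-spec (toℕ i) (toℕ j) (yields refl) (yields refl))
      (andF-spec (bitF-spec R i j (yields refl) (yields refl) (yields refl))
                 (bitF-spec R j i (yields refl) (yields refl) (yields refl)))

-- From here on the environment lists the redundant elements, R, n, Σ, 𝓑⁺
-- and, as its last tail, 𝓑⁻.
arcConditionF arcPremiseF arcF arcsF goalsF cmiBaseF : PolyFun
arcConditionF = andF (bitF (ref 3) (ref 1) (ref 0))
                     (orF (notF (bitF (ref 3) (ref 0) (ref 1))) (ltF (ref 1) (ref 0)))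
arcPremiseF   = tabulateF (andF (andF (bitF (ref 4) (ref 2) (ref 0)) (bitF (ref 4) (ref 0) (ref 2)))
                                (notF (bitF (ref 4) (ref 1) (ref 2))))
                          (ref 4)
-- As the new point has number `zero`, prefixing `nil` both extends a characteristic vector by
-- `outside` and takes the successor of a numeral.
arcF          = pairF (pairF nilF arcPremiseF) (pairF nilF (ref 0))
arcsF         = concatMapF (concatMapF (ifF arcConditionF then pairF arcF nilF else nilF)
                                       (rangeF (ref 3)))
                           (rangeF (ref 2))
goalsF        = mapF (pairF (pairF nilF (ref 0)) nilF) (exprF (drop 5))
cmiBaseF      = appendF arcsF goalsF

upperRowF lowerRowF cmiFamilyF cmiInstanceF reductionF : PolyFun
upperRowF    = tabulateF (orF (notF (bitF (ref 3) (ref 0) (ref 1))) (nthF (ref 2) (ref 0))) (ref 3)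
lowerRowF    = tabulateF (orF (nthF (ref 1) (ref 0)) (nthF (ref 2) (ref 0))) (ref 3)
cmiFamilyF   = appendF (mapF (pairF trueF upperRowF) (rangeF (ref 2)))
                       (mapF (pairF nilF lowerRowF) (ref 4))
cmiInstanceF = pairF (pairF nilF (ref 2)) (pairF cmiBaseF cmiFamilyF)
reductionF   = cmiInstanceF ∘F pairF redundantF (exprF var) ∘F pairF generatedF (exprF var)

module _ {n : ℕ} (R : Rel n) (Σ : Base n) (𝓑⁺ 𝓑⁻ : Family n) where

  private
    d : Tree
    d = cons (encodeSubset (tabulate (redundant R))) (cons (encodeRel R)
          (cons (encodeℕ n) (cons (encodeBase Σ) (cons (encodeFamily 𝓑⁺) (encodeFamily 𝓑⁻)))))

  arcConditionF-spec : ∀ i j → arcConditionF at cons (encodeFin j) (cons (encodeFin i) d)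
                               yields encodeBool (arcCondition R i j)
  arcConditionF-spec i j =
    andF-spec (bitF-spec R i j (yields refl) (yields refl) (yields refl))
      (orF-spec (notF-spec (bitF-spec R j i (yields refl) (yields refl) (yields refl)))
                (ltF-spec (toℕ i) (toℕ j) (yields refl) (yields refl)))

  arcPremiseF-spec : ∀ i j → arcPremiseF at cons (encodeFin j) (cons (encodeFin i) d)
                             yields encodeSubset (arcPremise R i j)
  arcPremiseF-spec i j = tabulateF-spec encodeBool (yields refl) λ k →
    andF-spec
      (andF-spec (bitF-spec R i k (yields refl) (yields refl) (yields refl))
                 (bitF-spec R k i (yields refl) (yields refl) (yields refl)))
      (notF-spec (bitF-spec R j i (yields refl) (yields refl) (yields refl)))

  arcF-spec : ∀ i j → arcF at cons (encodeFin j) (cons (encodeFin i) d)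
                      yields encodeImplication (arc R i j)
  arcF-spec i j = pairF-spec (pairF-spec (yields refl) (arcPremiseF-spec i j))
                             (pairF-spec (yields refl) (yields refl))

  arcsF-spec : arcsF at d yields encodeBase (arcs R)
  arcsF-spec = concatMapF-spec encodeFin encodeImplication (rangeF-spec (yields refl)) λ i →
    concatMapF-spec encodeFin encodeImplication (rangeF-spec (yields refl)) λ j →
      ifF-spec {e = encodeBase} {x = [ arc R i j ]} {y = []}
        (arcConditionF-spec i j) (pairF-spec (arcF-spec i j) (yields refl)) (yields refl)

  cmiBaseF-spec : cmiBaseF at d yields encodeBase (cmiBase R 𝓑⁻)
  cmiBaseF-spec = appendF-spec encodeImplication arcsF-spec
    (mapF-spec encodeSubset encodeImplication {xs = 𝓑⁻} (yields refl) λ B →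
      pairF-spec (pairF-spec (yields refl) (yields refl)) (yields refl))

  upperRowF-spec : ∀ x → upperRowF at cons (encodeFin x) d yields encodeSubset (saturate R (notAbove R x))
  upperRowF-spec x = tabulateF-spec encodeBool (yields refl) λ y →
    orF-spec
      (subst (λ b → _ at cons (encodeFin y) (cons (encodeFin x) d) yields encodeBool b)
        (sym (lookup∘tabulate (λ y → not (R y x)) y))
        (notF-spec (bitF-spec R y x (yields refl) (yields refl) (yields refl))))
      (nthF-tabulate (redundant R) y (yields refl) (yields refl))

  lowerRowF-spec : ∀ B → lowerRowF at cons (encodeSubset B) d yields encodeSubset (saturate R B)
  lowerRowF-spec B = tabulateF-spec encodeBool (yields refl) λ y →
    orF-spec (nthF-spec encodeBool B y (yields refl) (yields refl))
             (nthF-tabulate (redundant R) y (yields refl) (yields refl))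

  cmiFamilyF-spec : cmiFamilyF at d yields encodeFamily (cmiFamily R 𝓑⁺)
  cmiFamilyF-spec = appendF-spec encodeSubset
    (mapF-spec encodeFin encodeSubset (rangeF-spec (yields refl))
      λ x → pairF-spec (yields refl) (upperRowF-spec x))
    (mapF-spec encodeSubset encodeSubset {xs = 𝓑⁺} (yields refl)
      λ B → pairF-spec (yields refl) (lowerRowF-spec B))

  cmiInstanceF-spec : cmiInstanceF at d yields
    cons (encodeℕ (suc n)) (cons (encodeBase (cmiBase R 𝓑⁻)) (encodeFamily (cmiFamily R 𝓑⁺)))
  cmiInstanceF-spec = pairF-spec (pairF-spec (yields refl) (yields refl))
                                 (pairF-spec cmiBaseF-spec cmiFamilyF-spec)

reductionF-spec : ∀ {n} (Σ : Base n) 𝓑⁺ 𝓑⁻ → let R = generated Σ in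
  reductionF at cons (encodeℕ n) (cons (encodeBase Σ) (cons (encodeFamily 𝓑⁺) (encodeFamily 𝓑⁻))) yields
  cons (encodeℕ (suc n)) (cons (encodeBase (cmiBase R 𝓑⁻)) (encodeFamily (cmiFamily R 𝓑⁺)))
reductionF-spec Σ 𝓑⁺ 𝓑⁻ = ∘F-spec
  (∘F-spec (pairF-spec (generatedF-spec Σ _) (yields refl))
           (pairF-spec (redundantF-spec (generated Σ) _) (yields refl)))
  (cmiInstanceF-spec (generated Σ) Σ 𝓑⁺ 𝓑⁻)

-- Correctness of the reduction

module _ (I : DUAL-Instance) (unit : UnitPremises (DUAL-Instance.Σ I)) where

  open DUAL-Instance I

  private
    R : Rel n
    R = generated Σ

    up⇒closed : ∀ {S} → UpClosed R S → Closed Σ S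
    up⇒closed {S} = from (closed⇔upClosed Σ unit S)

    closed⇒up : ∀ {S} → Closed Σ S → UpClosed R S
    closed⇒up {S} = to (closed⇔upClosed Σ unit S)

    up⁺ : ∀ {B} → B ∈ 𝓑⁺ → UpClosed R B
    up⁺ B∈ = closed⇒up (Antichain.closed 𝓑⁺-antichain B∈)

    up⁻ : ∀ {B} → B ∈ 𝓑⁻ → UpClosed R B
    up⁻ B∈ = closed⇒up (Antichain.closed 𝓑⁻-antichain B∈)

  open Correctness R (generated-preorder Σ) 𝓑⁻ up⁻

  -- Disjointness says that the members of `𝓑⁺` avoid `𝓑⁻`, covering that every avoiding closed set
  -- lies below one of them; incomparability then makes each member maximal. Conversely, `extend`
  -- places every avoiding closed set below a maximal one.
  DUAL⇔maximal : Yes DUAL I ⇔ (∀ S → S ∈ 𝓑⁺ ⇔ Maximal S)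
  DUAL⇔maximal = mk⇔ forth back
    where
    forth : Yes DUAL I → ∀ S → S ∈ 𝓑⁺ ⇔ Maximal S
    forth ((disjoint , _) , (_ , covering)) S = mk⇔ sound complete
      where
      avoids : ∀ {B} → B ∈ 𝓑⁺ → Avoiding B
      avoids B∈ B′∈ B′⊆ = disjoint
        (let cl = Antichain.closed 𝓑⁺-antichain B∈ in (cl , _ , B∈ , ⊆-refl) , (cl , _ , B′∈ , B′⊆))
      below : ∀ {S} → UpClosed R S → Avoiding S → ∃[ B ] B ∈ 𝓑⁺ × S ⊆ B
      below up av with covering (up⇒closed up)
      ... | inj₁ (_ , hit) = hit
      ... | inj₂ (_ , B , B∈ , B⊆) = ⊥-elim (av B∈ B⊆)
      sound : S ∈ 𝓑⁺ → Maximal S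
      sound S∈ = record
        { upClosed = up⁺ S∈
        ; avoiding = avoids S∈
        ; maximal  = λ up′ av′ S⊆S′ →
            let B , B∈ , S′⊆B = below up′ av′
            in subst (_ ⊆_) (sym (Antichain.incomparable 𝓑⁺-antichain S∈ B∈ (⊆-trans S⊆S′ S′⊆B))) S′⊆B
        }
      complete : Maximal S → S ∈ 𝓑⁺
      complete max =
        let open Maximal max
            B , B∈ , S⊆B = below upClosed avoiding
        in subst (_∈ 𝓑⁺) (⊆-antisym (maximal (up⁺ B∈) (avoids B∈) S⊆B) S⊆B) B∈
    back : (∀ S → S ∈ 𝓑⁺ ⇔ Maximal S) → Yes DUAL I
    back h = ((λ {S} → disjoint {S}) , λ ()) , ([ proj₁ , proj₁ ]′ , covering)
      where
      disjoint : ∀ {S} → ↓ Σ 𝓑⁺ S × ↑ Σ 𝓑⁻ S → ⊥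
      disjoint ((_ , B , B∈ , S⊆B) , (_ , B′ , B′∈ , B′⊆S)) =
        Maximal.avoiding (to (h B) B∈) B′∈ (⊆-trans B′⊆S S⊆B)
      covering : ∀ {S} → Closed Σ S → ↓ Σ 𝓑⁺ S ⊎ ↑ Σ 𝓑⁻ S
      covering {S} cl with hit? S
      ... | yes hit = inj₂ (cl , find hit)
      ... | no ¬hit =
        let S′ , max , S⊆S′ = extend S (closed⇒up cl) (¬hit⇒avoiding ¬hit)
        in inj₁ (cl , S′ , from (h S′) max , S⊆S′)

  cmiInstance : Instance AcyclicCMI
  cmiInstance = record { Σ = cmiBase R 𝓑⁻ ; 𝓜 = cmiFamily R 𝓑⁺ } , acyclic

  cmi⇔dual : Yes AcyclicCMI cmiInstance ⇔ Yes DUAL I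
  cmi⇔dual = ⇔-sym DUAL⇔maximal ⇔-∘ CMI⇔maximal 𝓑⁺ up⁺

-- Polynomial-time many-one reductions

record _≤ₚ_ (P Q : Problem) : Set where
  field
    reduce   : Instance P → Instance Q
    computer : PolyFun
    computes : ∀ x → computer at encode P x yields encode Q (reduce x)
    correct  : ∀ x → Yes Q (reduce x) ⇔ Yes P x

-- The time of the solver is measured in the size of the reduced instance, which `space computer`
-- bounds in the size of the original one; `monomial-bound` brings the total back to the required
-- shape.
polyTime-≤ₚ : ∀ {P Q} → P ≤ₚ Q → PolyTime Q → PolyTime P
polyTime-≤ₚ {P} {Q} P≤Q (p , c , k , solves) =
  program computer ﹔ p , c′ , k′ , λ x →
    let s = size (encode P x)
        t₁ , run₁ , t₁≤ = halts computer (encode P x)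
        out , t₂ , run₂ , t₂≤ , answer = solves (reduce x)
        run₁′ = subst (λ d → ⟨ program computer , encode P x ⟩⇓ d [ t₁ ]) (equation (computes x)) run₁
        size≤ = subst (λ d → size d ≤ ⟪ space computer ⟫ s) (equation (computes x)) (bounded computer (encode P x))
        t₂≤′ = ≤-trans t₂≤ (+-monoˡ-≤ c (*-monoʳ-≤ c
                 (≤-trans (^-monoˡ-≤ k size≤) (≤-reflexive (sym (⟪⟫-⊗^ (space computer) k s))))))
    in out , suc (t₁ + t₂) , seq run₁′ run₂
       , ≤-trans (s≤s (+-mono-≤ t₁≤ t₂≤′))
           (≤-trans (bound s {{size-nonZero (encode P x)}}) (m≤m+n _ c′))
       , correct x ⇔-∘ answer
  where
  open _≤ₚ_ P≤Q
  total : Polynomial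
  total = con 1 ⊕ (time computer ⊕ (con c ⊗ space computer ⊗^ k ⊕ con c))
  c′ k′ : ℕ
  c′ = proj₁ (monomial-bound total)
  k′ = proj₁ (proj₂ (monomial-bound total))
  bound : ∀ n → .{{_ : NonZero n}} → ⟪ total ⟫ n ≤ c′ * n ^ k′
  bound = proj₂ (proj₂ (monomial-bound total))

DUAL≤CMI : DistributiveDUAL ≤ₚ AcyclicCMI
DUAL≤CMI = record
  { reduce   = λ (I , unit) → cmiInstance I unit
  ; computer = reductionF
  ; computes = λ (I , unit) → let open DUAL-Instance I in reductionF-spec Σ 𝓑⁺ 𝓑⁻
  ; correct  = λ (I , unit) → cmi⇔dual I unit
  }

theorem1 : PolyTime AcyclicCMI → PolyTime DistributiveDUAL
theorem1 = polyTime-≤ₚ DUAL≤CMI
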